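{- Let $G$ be a tree-cograph and let $T$ be a decomposition tree for $G$. There exists a linear-time algorithm that, given $G$ by means of its decomposition tree $T$ as part of the input, computes the strong chromatic index $s\chi'(G)$ of $G$.
   Context: All graphs are finite, simple and undirected. For a graph $G$, $\bar G$ denotes its complement. Tree-cographs are defined recursively: (1) every tree is a tree-cograph; (2) if $G$ is a tree-cograph then its complement $\bar G$ is a tree-cograph; (3) for $k\ge 2$, if $G_1,\ldots,G_k$ are connected tree-cographs then their disjoint union is a tree-cograph. A decomposition tree for a tree-cograph $G$ is a rooted binary tree in which each internal node (including the root) is labeled as a join node $\otimes$ or a union node $\oplus$, and whose leaves are labeled by trees or complements of trees; the graph $G$ is obtained by evaluating this tree bottom-up, where a union node takes the disjoint union of the graphs of its two children and a join node takes their join (the disjoint union together with all edges between the two vertex sets). A strong edge coloring of $G$ is a proper edge coloring such that no edge is adjacent to two edges of the same color; equivalently, it is a proper vertex coloring of $L(G)^2$, the square of the linegraph $L(G)$ (the vertices of $L(G)$ are the edges of $G$, two being adjacent if they share an endpoint; the square $H^2$ of a graph $H$ has the same vertices as $H$, with two distinct vertices adjacent if their distance in $H$ is at most $2$). The strong chromatic index $s\chi'(G)$ is the minimal integer $k$ such that $G$ has a strong edge coloring with $k$ colors. Linear time means $O(n)$ time, where $n$ is the number of vertices of $G$, the decomposition tree being a part of the input. -}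

module Defs where

open import Data.Bool.Base using (Bool; true; false; not; _∧_; T; if_then_else_)
open import Data.Bool.Properties using (T?; ∧-zeroʳ)
open import Data.Fin.Base using (Fin; toℕ; splitAt) renaming (_<_ to _<ᶠ_)
open import Data.Fin.Properties using (_≟_; _<?_)
open import Data.List.Base
  using (List; []; _∷_; _++_; [_]; length; foldr; filter; concatMap; allFin; cartesianProduct)
open import Data.List.Relation.Binary.Permutation.Propositional using (_↭_)
open import Data.List.Relation.Unary.All using (All)
open import Data.List.Relation.Unary.Linked using (Linked)
open import Data.List.Relation.Unary.Unique.Propositional using (Unique)
open import Data.Nat.Base using (ℕ; zero; suc; _+_; _∸_; _*_; _^_; _≤_; _<_; _≡ᵇ_)
open import Data.Product.Base using (Σ-syntax; ∃-syntax; _×_; _,_; proj₁)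
open import Data.Sum.Base using (_⊎_; inj₁; inj₂)
open import Function.Bundles using (_↔_; Inverse; _⇔_; mk⇔)
open import Relation.Binary.Construct.Closure.ReflexiveTransitive using (Star)
open import Relation.Binary.PropositionalEquality
  using (_≡_; _≢_; refl; sym; trans; cong; cong₂; ≢-sym)
open import Relation.Nullary using (¬_; Dec; yes; no; does; contradiction)
open import Relation.Nullary.Decidable using (_×-dec_)

------------------------------------------------------------------------
-- Finite simple graphs

record Graph : Set where
  field
    order      : ℕ
    adj        : Fin order → Fin order → Bool
    adj-sym    : ∀ u v → adj u v ≡ adj v u
    adj-irrefl : ∀ v → adj v v ≡ false

  Vertex : Set
  Vertex = Fin order

  Adj : Vertex → Vertex → Set
  Adj u v = T (adj u v)

open Graph public

record _≅_ (G H : Graph) : Set where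
  field
    bijection : Vertex G ↔ Vertex H
    preserves : ∀ u v → adj G u v ≡ adj H (Inverse.to bijection u) (Inverse.to bijection v)

≟-sym : ∀ {n} (u v : Fin n) → does (u ≟ v) ≡ does (v ≟ u)
≟-sym u v with u ≟ v | v ≟ u
... | yes _ | yes _ = refl
... | no  _ | no  _ = refl
... | yes p | no ¬q = contradiction (sym p) ¬q
... | no ¬p | yes q = contradiction (sym q) ¬p

≟-refl : ∀ {n} (v : Fin n) → does (v ≟ v) ≡ true
≟-refl v with v ≟ v
... | yes _ = refl
... | no ¬p = contradiction refl ¬p

complement : Graph → Graph
complement G = record
  { order      = order G
  ; adj        = λ u v → not (adj G u v) ∧ not (does (u ≟ v))
  ; adj-sym    = λ u v → cong₂ (λ a b → not a ∧ not b) (adj-sym G u v) (≟-sym u v)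
  ; adj-irrefl = λ v → trans (cong (λ b → not (adj G v v) ∧ not b) (≟-refl v))
                             (∧-zeroʳ (not (adj G v v)))
  }

emptyGraph : Graph
emptyGraph = record { order = 0 ; adj = λ () ; adj-sym = λ () ; adj-irrefl = λ () }

-- Two graphs side by side; b tells whether vertices on different sides are adjacent.
module _ (b : Bool) (G H : Graph) where

  sumAdj : Vertex G ⊎ Vertex H → Vertex G ⊎ Vertex H → Bool
  sumAdj (inj₁ u) (inj₁ v) = adj G u v
  sumAdj (inj₁ _) (inj₂ _) = b
  sumAdj (inj₂ _) (inj₁ _) = b
  sumAdj (inj₂ u) (inj₂ v) = adj H u v

  sumAdj-sym : ∀ x y → sumAdj x y ≡ sumAdj y x
  sumAdj-sym (inj₁ u) (inj₁ v) = adj-sym G u v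
  sumAdj-sym (inj₁ _) (inj₂ _) = refl
  sumAdj-sym (inj₂ _) (inj₁ _) = refl
  sumAdj-sym (inj₂ u) (inj₂ v) = adj-sym H u v

  sumAdj-irrefl : ∀ x → sumAdj x x ≡ false
  sumAdj-irrefl (inj₁ v) = adj-irrefl G v
  sumAdj-irrefl (inj₂ v) = adj-irrefl H v

  sumGraph : Graph
  sumGraph = record
    { order      = order G + order H
    ; adj        = λ u v → sumAdj (splitAt (order G) u) (splitAt (order G) v)
    ; adj-sym    = λ u v → sumAdj-sym (splitAt (order G) u) (splitAt (order G) v)
    ; adj-irrefl = λ v → sumAdj-irrefl (splitAt (order G) v)
    }

disjointUnion join : Graph → Graph → Graph
disjointUnion = sumGraph false
join          = sumGraph true

⨆ : List Graph → Graph
⨆ = foldr disjointUnion emptyGraph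

------------------------------------------------------------------------
-- Trees and tree-cographs

Connected : Graph → Set
Connected G = 1 ≤ order G × (∀ u v → Star (Adj G) u v)

-- A cycle is given by its distinct vertices in cyclic order.
IsCycle : (G : Graph) → Vertex G → List (Vertex G) → Set
IsCycle G v vs = 2 ≤ length vs × Unique (v ∷ vs) × Linked (Adj G) (v ∷ vs ++ [ v ])

Acyclic : Graph → Set
Acyclic G = ∀ v vs → ¬ IsCycle G v vs

IsTree : Graph → Set
IsTree G = Connected G × Acyclic G

-- The last rule closes the class under isomorphism, since ⨆ fixes one
-- particular numbering of the vertices.
data TreeCograph : Graph → Set where
  tree   : ∀ {G} → IsTree G → TreeCograph G
  compl  : ∀ {G} → TreeCograph G → TreeCograph (complement G)
  union  : ∀ Gs → 2 ≤ length Gs → All (λ G → Connected G × TreeCograph G) Gs →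
           TreeCograph (⨆ Gs)
  iso    : ∀ {G H} → G ≅ H → TreeCograph G → TreeCograph H

infixl 6 _⊕_ _⊗_

data DecompositionTree : Set where
  tree   : (t : Graph) → IsTree t → DecompositionTree
  cotree : (t : Graph) → IsTree t → DecompositionTree
  _⊕_    : DecompositionTree → DecompositionTree → DecompositionTree
  _⊗_    : DecompositionTree → DecompositionTree → DecompositionTree

eval : DecompositionTree → Graph
eval (tree t _)   = t
eval (cotree t _) = complement t
eval (D₁ ⊕ D₂)    = disjointUnion (eval D₁) (eval D₂)
eval (D₁ ⊗ D₂)    = join (eval D₁) (eval D₂)

_IsDecompositionTreeOf_ : DecompositionTree → Graph → Set
D IsDecompositionTreeOf G = eval D ≅ G

------------------------------------------------------------------------
-- Strong edge colorings

-- Each edge is represented once, with its smaller endpoint first.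
IsEdge : (G : Graph) → Vertex G × Vertex G → Set
IsEdge G (u , v) = u <ᶠ v × Adj G u v

isEdge? : (G : Graph) → ∀ e → Dec (IsEdge G e)
isEdge? G (u , v) = (u <? v) ×-dec T? (adj G u v)

Edge : Graph → Set
Edge G = Σ[ e ∈ Vertex G × Vertex G ] IsEdge G e

edges : (G : Graph) → List (Vertex G × Vertex G)
edges G = filter (isEdge? G) (cartesianProduct (allFin (order G)) (allFin (order G)))

module _ (G : Graph) where

  EndpointOf : Vertex G → Edge G → Set
  EndpointOf w ((u , v) , _) = w ≡ u ⊎ w ≡ v

  -- The adjacency relation of the linegraph.
  EdgeAdj : Edge G → Edge G → Set
  EdgeAdj e f = e ≢ f × (∃[ w ] EndpointOf w e × EndpointOf w f)

-- The adjacency relation of the square of a graph.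
Square : {A : Set} → (A → A → Set) → A → A → Set
Square R x y = x ≢ y × (R x y ⊎ (∃[ z ] R x z × R z y))

ProperColoring : {A : Set} → (A → A → Set) → ∀ {k} → (A → Fin k) → Set
ProperColoring R c = ∀ x y → R x y → c x ≢ c y

StrongEdgeColoring : (G : Graph) → ∀ {k} → (Edge G → Fin k) → Set
StrongEdgeColoring G c =
  ProperColoring (EdgeAdj G) c ×
  (∀ e f g → f ≢ g → EdgeAdj G e f → EdgeAdj G e g → c f ≢ c g)

strong⇔square : ∀ G {k} (c : Edge G → Fin k) →
  StrongEdgeColoring G c ⇔ ProperColoring (Square (EdgeAdj G)) c
strong⇔square G c = mk⇔ to from
  where
  EdgeAdj-sym : ∀ {e f} → EdgeAdj G e f → EdgeAdj G f e
  EdgeAdj-sym (e≢f , w , p , q) = ≢-sym e≢f , w , q , p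

  to : StrongEdgeColoring G c → ProperColoring (Square (EdgeAdj G)) c
  to (proper , _) x y (_ , inj₁ r)             = proper x y r
  to (_ , strong) x y (x≢y , inj₂ (z , r , s)) = strong z x y x≢y (EdgeAdj-sym r) s

  from : ProperColoring (Square (EdgeAdj G)) c → StrongEdgeColoring G c
  from h = (λ x y r → h x y (proj₁ r , inj₁ r))
         , (λ e f g f≢g r s → h f g (f≢g , inj₂ (e , EdgeAdj-sym r , s)))

StronglyEdgeColorable : Graph → ℕ → Set
StronglyEdgeColorable G k = Σ[ c ∈ (Edge G → Fin k) ] StrongEdgeColoring G c

IsStrongChromaticIndex : Graph → ℕ → Set
IsStrongChromaticIndex G k =
  StronglyEdgeColorable G k × (∀ j → StronglyEdgeColorable G j → k ≤ j)

------------------------------------------------------------------------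
-- Decomposition trees as input data

-- A labeled tree is written as its number of vertices, its number of edges and
-- an edge list in arbitrary order.  This takes linearly many words only because a
-- leaf labeled by the complement of a tree is given by the tree itself.
treeWord : (t : Graph) → List (Vertex t × Vertex t) → List ℕ
treeWord t es =
  order t ∷ length es ∷ concatMap (λ (u , v) → toℕ u ∷ toℕ v ∷ []) es

-- The tree is serialized in postorder, each node carrying a tag for its kind.
data Encodes : DecompositionTree → List ℕ → Set where
  tree   : ∀ {t p es} → es ↭ edges t → Encodes (tree t p)   (0 ∷ treeWord t es)
  cotree : ∀ {t p es} → es ↭ edges t → Encodes (cotree t p) (1 ∷ treeWord t es)
  _⊕_    : ∀ {D₁ D₂ w₁ w₂} → Encodes D₁ w₁ → Encodes D₂ w₂ →
           Encodes (D₁ ⊕ D₂) (w₁ ++ w₂ ++ [ 2 ])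
  _⊗_    : ∀ {D₁ D₂ w₁ w₂} → Encodes D₁ w₁ → Encodes D₂ w₂ →
           Encodes (D₁ ⊗ D₂) (w₁ ++ w₂ ++ [ 3 ])

------------------------------------------------------------------------
-- Random access machine with unit costs and bounded words, programmed with
-- structured control flow

Reg : Set
Reg = ℕ

data Op : Set where
  add sub mul : Op

⟦_⟧ : Op → ℕ → ℕ → ℕ
⟦ add ⟧ = _+_
⟦ sub ⟧ = _∸_
⟦ mul ⟧ = _*_

data Expr : Set where
  const : ℕ → Expr
  reg   : Reg → Expr
  op    : Op → Reg → Reg → Expr
  load  : Reg → Expr

infix  5 _≔_
infixr 4 _⨾_

-- Conditions test whether a register is nonzero.
data Program : Set where
  skip     : Program
  _≔_      : Reg → Expr → Program
  store    : (address value : Reg) → Program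
  _⨾_      : Program → Program → Program
  ifnz     : Reg → Program → Program → Program
  while    : Reg → Program → Program

record State : Set where
  constructor state
  field
    regs : Reg → ℕ
    mem  : ℕ → ℕ

open State public

_[_↦_] : (ℕ → ℕ) → ℕ → ℕ → ℕ → ℕ
(f [ a ↦ x ]) b = if a ≡ᵇ b then x else f b

value : Expr → State → ℕ
value (const k)  s = k
value (reg r)    s = regs s r
value (op o r q) s = ⟦ o ⟧ (regs s r) (regs s q)
value (load r)   s = mem s (regs s r)

-- Run W P s t s′: started in s, program P halts in s′ after t steps, and all
-- values it computes on the way are less than W.  There is no rule for an
-- assignment that would overflow.
data Run (W : ℕ) : Program → State → ℕ → State → Set where
  skip   : ∀ {s} → Run W skip s 1 s
  assign : ∀ {r e s} → value e s < W →
           Run W (r ≔ e) s 1 (state (regs s [ r ↦ value e s ]) (mem s))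
  store  : ∀ {a v s} →
           Run W (store a v) s 1 (state (regs s) (mem s [ regs s a ↦ regs s v ]))
  seq    : ∀ {P Q s s′ s″ t t′} → Run W P s t s′ → Run W Q s′ t′ s″ →
           Run W (P ⨾ Q) s (t + t′) s″
  if-≢0  : ∀ {r P Q s s′ t} → regs s r ≢ 0 → Run W P s t s′ →
           Run W (ifnz r P Q) s (suc t) s′
  if-≡0  : ∀ {r P Q s s′ t} → regs s r ≡ 0 → Run W Q s t s′ →
           Run W (ifnz r P Q) s (suc t) s′
  loop   : ∀ {r P s s′ s″ t t′} → regs s r ≢ 0 → Run W P s t s′ →
           Run W (while r P) s′ t′ s″ → Run W (while r P) s (suc (t + t′)) s″
  exit   : ∀ {r P s} → regs s r ≡ 0 → Run W (while r P) s 1 s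

cells : List ℕ → ℕ → ℕ
cells []       _       = 0
cells (x ∷ _)  zero    = x
cells (_ ∷ xs) (suc i) = cells xs i

-- The input word occupies the memory cells from 0 on, and register 0 holds its
-- length.  All other registers and cells are 0.
initial : List ℕ → State
initial w = state ((λ _ → 0) [ 0 ↦ length w ]) (cells w)

output : State → ℕ
output s = regs s 0

-- On an n-vertex graph given by a decomposition tree, P halts after at most
-- c * n steps with the strong chromatic index as output, using words of
-- d * log₂ (1 + n) bits.
ComputesStrongChromaticIndex : Program → (c d : ℕ) → Graph → DecompositionTree → Set
ComputesStrongChromaticIndex P c d G D =
  ∀ w → Encodes D w →
  ∃[ t ] ∃[ s ] Run (suc (order G) ^ d) P (initial w) t s
              × t ≤ c * order G
              × IsStrongChromaticIndex G (output s)

module Submission where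

open import Defs
open import Data.Bool.Base using (Bool; true; false; T; if_then_else_)
open import Data.Bool.Properties using (T?; T-irrelevant)
open import Data.Empty using (⊥; ⊥-elim)
open import Data.Fin.Base as Fin using (Fin; toℕ; splitAt; zero; suc) renaming (_<_ to _<ᶠ_)
open import Data.Fin.Permutation using (↔⇒≡)
open import Data.Fin.Properties as Fin using (_≟_; any?; toℕ-injective; toℕ<n)
open import Data.List.Base as List
  using (List; []; _∷_; _++_; [_]; length; filter; map; concatMap; upTo; allFin; cartesianProduct)
open import Data.List.Membership.Propositional using (_∈_; _∉_; find)
open import Data.List.Membership.Propositional.Properties
open import Data.List.Properties using (length-map; length-++; length-upTo; length-tabulate)
open import Data.List.Relation.Binary.Permutation.Propositional as Perm using (_↭_; ↭-sym)
open import Data.List.Relation.Binary.Permutation.Propositional.Properties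
  using (↭-length; shift; ∈-resp-↭)
import Data.List.Relation.Binary.Permutation.Setoid.Properties as PermSetoid
open import Data.List.Relation.Unary.All as All using (All; []; _∷_)
open import Data.List.Relation.Unary.All.Properties using (¬All⇒Any¬)
open import Data.List.Relation.Unary.AllPairs as AllPairs using ([]; _∷_)
open import Data.List.Relation.Unary.Any using (here; there; index)
open import Data.List.Relation.Unary.Any.Properties using (lookup-index)
open import Data.List.Relation.Unary.Linked as Linked using (Linked; []; [-]; _∷_)
open import Data.List.Relation.Unary.Unique.Propositional using (Unique)
import Data.List.Relation.Unary.Unique.Propositional.Properties as Unique
open import Data.Nat.Base
open import Data.Nat.Properties as ℕ hiding (_≟_; _<?_)
open import Data.Nat.Tactic.RingSolver using (solve-∀)
open import Data.Product.Base using (∃-syntax; _×_; _,_; proj₁; proj₂)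
open import Data.Product.Properties using (≡-dec)
open import Data.Sum.Base using (_⊎_; inj₁; inj₂; [_,_]′)
open import Data.Unit.Base using (⊤; tt)
open import Function.Base using (_∘_; id)
open import Function.Bundles using (Inverse)
open import Relation.Binary.Definitions using (tri<; tri≈; tri>)
open import Relation.Binary.PropositionalEquality hiding ([_])
open import Relation.Nullary using (¬_; Dec; yes; no; does; contradiction)
open import Relation.Nullary.Decidable using (_×-dec_; ¬?; _⊎-dec_; dec-true; dec-false)
open import Data.List.Membership.DecPropositional ℕ._≟_ using () renaming (_∈?_ to _∈ℕ?_)

-- Two distinct edges do not conflict exactly if they are disjoint and no edge
-- joins them.  In a join, the new edges conflict with all edges and edges of
-- different sides conflict, so the index of G ⊗ H is that of G plus that of H
-- plus |G| |H|; that of G ⊕ H is the maximum.  In the complement of a tree two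
-- non-conflicting edges would span a 4-cycle of the tree, so all edges need
-- different colors, and there are n(n − 1)/2 minus the edges of the tree.  In a
-- tree the index is the maximum of d(u) + d(v) − 1 over the edges uv: the edges
-- at u or v pairwise conflict, and conversely the end of a longest path yields a
-- leaf y at p such that all neighbors of p but one, q, are leaves, so that the
-- edge yp conflicts only with edges at p or q and can be colored last.
--
-- These rules are evaluated along the postorder word with a stack.  It fits into
-- the part of the word already read, and the degrees in each tree are counted in
-- fresh memory, which is known to be 0, so nothing has to be cleared.

-- The coloring induction removes an edge but keeps its endpoints. The numbering of the vertices
-- stays fixed and connectedness is lost, so it runs over forests given as edge lists, and degrees
-- are lengths of filtered lists.
--
-- On the machine, running time, overflow and aliasing have to be controlled together in one
-- induction over the postorder word. Stack, unread input and heap must stay apart: a leaf is read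
-- from at least three words and leaves two stack cells, an inner node turns four cells into two, so
-- the stack never catches up with the input pointer. Overflow is measured against the single number
-- 8N + N²: the word takes at most 6N cells, the heap N more, and no index exceeds N². Time is
-- amortized: every subtree reserves 25 steps, and as an inner node has two children, one reserve
-- pays for the node and the other is handed on. The same device with a reserve of one word bounds
-- the length of the input by 6N.

-- Counting with duplicate-free lists

unique-↭ : {A : Set} {xs ys : List A} → xs ↭ ys → Unique xs → Unique ys
unique-↭ {A} xs↭ys = PermSetoid.Unique-resp-↭ (setoid A) (Perm.↭⇒↭ₛ xs↭ys)

unique-∷ : {A : Set} {x : A} {xs : List A} → x ∉ xs → Unique xs → Unique (x ∷ xs)
unique-∷ x∉xs u = All.tabulate (λ z∈xs x≡z → x∉xs (subst (_∈ _) (sym x≡z) z∈xs)) ∷ u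

-- The pigeonhole principle, from which the lower bounds for joins, complements of trees and trees
-- are drawn. The head `x` is cut out of `ys`, and uniqueness keeps the tail inside what remains.
unique-⊆-length : {A : Set} {xs ys : List A} → Unique xs → (∀ {x} → x ∈ xs → x ∈ ys) →
                  length xs ≤ length ys
unique-⊆-length {xs = []}     _ _ = z≤n
unique-⊆-length {xs = x ∷ xs} u@(_ ∷ u′) xs⊆ys
  with as , bs , refl ← ∈-∃++ (xs⊆ys (here refl)) =
  ≤-trans (s≤s (unique-⊆-length u′ rest)) (≤-reflexive (sym (↭-length (shift x as bs))))
  where
  rest : ∀ {z} → z ∈ xs → z ∈ as ++ bs
  rest z∈xs with ∈-resp-↭ (shift x as bs) (xs⊆ys (there z∈xs))
  ... | here refl = ⊥-elim (Unique.Unique[x∷xs]⇒x∉xs u z∈xs)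
  ... | there z∈  = z∈

unique-map : {A B : Set} (f : A → B) {xs : List A} →
             (∀ {x y} → x ∈ xs → y ∈ xs → f x ≡ f y → x ≡ y) → Unique xs → Unique (map f xs)
unique-map f {[]}     inj _ = []
unique-map f {x ∷ xs} inj u@(_ ∷ u′) =
  unique-∷ fx∉ (unique-map f (λ p q → inj (there p) (there q)) u′)
  where
  fx∉ : f x ∉ map f xs
  fx∉ fx∈ with y , y∈ , eq ← ∈-map⁻ f fx∈ =
    Unique.Unique[x∷xs]⇒x∉xs u (subst (_∈ xs) (sym (inj (here refl) (there y∈) eq)) y∈)

length-cartesianProduct : {A B : Set} (xs : List A) (ys : List B) →
                          length (cartesianProduct xs ys) ≡ length xs * length ys
length-cartesianProduct []       ys = refl
length-cartesianProduct (x ∷ xs) ys = begin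
  length (map (x ,_) ys ++ cartesianProduct xs ys)
    ≡⟨ length-++ (map (x ,_) ys) ⟩
  length (map (x ,_) ys) + length (cartesianProduct xs ys)
    ≡⟨ cong₂ _+_ (length-map (x ,_) ys) (length-cartesianProduct xs ys) ⟩
  length ys + length xs * length ys ∎
  where open ≡-Reasoning

length-grid : ∀ m n → length (cartesianProduct (allFin m) (allFin n)) ≡ m * n
length-grid m n = trans (length-cartesianProduct (allFin m) (allFin n))
  (cong₂ _*_ (length-tabulate {n = m} id) (length-tabulate {n = n} id))

-- If all colors below `k` occurred in `xs`, pigeonhole would give `k ≤ length xs`. This is the
-- greedy choice of a color for the last edge.
fresh : (xs : List ℕ) {k : ℕ} → length xs < k → ∃[ c ] c < k × c ∉ xs
fresh xs {k} xs<k with All.all? (_∈ℕ? xs) (upTo k)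
... | no ¬all = let c , c∈ , c∉ = find (¬All⇒Any¬ (_∈ℕ? xs) (upTo k) ¬all) in c , ∈-upTo⁻ c∈ , c∉
... | yes all = contradiction
  (≤-trans (≤-reflexive (sym (length-upTo k)))
           (unique-⊆-length (Unique.upTo⁺ k) (All.lookup all)))
  (<⇒≱ xs<k)

-- Strong edge colorings by palettes

-- `IsCycle` for an arbitrary relation, so that it also applies to edge lists; at `Adj G` the two
-- unfold to the same type.
Cycle : {V : Set} (R : V → V → Set) → V → List V → Set
Cycle R v vs = 2 ≤ length vs × Unique (v ∷ vs) × Linked R (v ∷ vs ++ [ v ])

SameEdge : {V : Set} (u v x y : V) → Set
SameEdge u v x y = (u ≡ x × v ≡ y) ⊎ (u ≡ y × v ≡ x)

-- A strong edge coloring is given as a function of the two endpoints, which is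
-- meaningful on edges only.  Up to renaming endpoints, two edges uv and xy
-- conflict if u ≡ x or u is adjacent to x.
record Palette {V : Set} (R : V → V → Set) {A : Set} (L : List A) : Set where
  field
    color      : V → V → A
    color-sym  : ∀ {u v} → R u v → color u v ≡ color v u
    in-palette : ∀ {u v} → R u v → color u v ∈ L
    strong     : ∀ {u v x y} → R u v → R x y → u ≡ x ⊎ R u x → color u v ≡ color x y →
                 SameEdge u v x y

open Palette

-- Conflicting edges stay conflicting under `f`, because `f` preserves adjacency, and injectivity
-- brings equality of edges back. It serves for isomorphisms, for the sides of a sum and for passing
-- from `Adj` to `Joined`.
pullback : {V V′ : Set} {R : V → V → Set} {R′ : V′ → V′ → Set} {A : Set} {L : List A}
           (f : V → V′) → (∀ {u v} → f u ≡ f v → u ≡ v) → (∀ {u v} → R u v → R′ (f u) (f v)) →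
           Palette R′ L → Palette R L
pullback f inj hom c = record
  { color      = λ u v → color c (f u) (f v)
  ; color-sym  = λ r → color-sym c (hom r)
  ; in-palette = λ r → in-palette c (hom r)
  ; strong     = λ r r′ near eq → back (strong c (hom r) (hom r′) (map-near near) eq)
  }
  where
  back : ∀ {u v x y} → SameEdge (f u) (f v) (f x) (f y) → SameEdge u v x y
  back (inj₁ (p , q)) = inj₁ (inj p , inj q)
  back (inj₂ (p , q)) = inj₂ (inj p , inj q)
  map-near : ∀ {u x} → u ≡ x ⊎ _ → f u ≡ f x ⊎ _
  map-near (inj₁ refl) = inj₁ refl
  map-near (inj₂ r)    = inj₂ (hom r)

module _ {G : Graph} where

  adj-symm : ∀ {u v} → Adj G u v → Adj G v u
  adj-symm {u} {v} = subst T (adj-sym G u v)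

  irreflexive : ∀ {v} → ¬ Adj G v v
  irreflexive {v} = subst T (adj-irrefl G v)

  _∋ₑ_ : Edge G → Vertex G → Set
  e ∋ₑ w = EndpointOf G w e

  edge-ext : {e f : Edge G} → proj₁ e ≡ proj₁ f → e ≡ f
  edge-ext {_ , p , q} {_ , p′ , q′} refl =
    cong₂ (λ p q → _ , p , q) (≤-irrelevant p p′) (T-irrelevant q q′)

  _≟ₑ_ : (e f : Edge G) → Dec (e ≡ f)
  e ≟ₑ f with ≡-dec _≟_ _≟_ (proj₁ e) (proj₁ f)
  ... | yes eq = yes (edge-ext eq)
  ... | no neq = no (neq ∘ cong proj₁)

  edgeOf : ∀ {u v} → Adj G u v → Edge G
  edgeOf {u} {v} a with Fin.<-cmp u v
  ... | tri< u<v _ _  = (u , v) , u<v , a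
  ... | tri≈ _ refl _ = contradiction a irreflexive
  ... | tri> _ _ v<u  = (v , u) , v<u , adj-symm a

  edgeOf-endpoints : ∀ {u v} (a : Adj G u v) → edgeOf a ∋ₑ u × edgeOf a ∋ₑ v
  edgeOf-endpoints {u} {v} a with Fin.<-cmp u v
  ... | tri< _ _ _    = inj₁ refl , inj₂ refl
  ... | tri≈ _ refl _ = contradiction a irreflexive
  ... | tri> _ _ _    = inj₂ refl , inj₁ refl

  edge-by-endpoints : ∀ {u v} (e f : Edge G) → u ≢ v → e ∋ₑ u → e ∋ₑ v → f ∋ₑ u → f ∋ₑ v → e ≡ f
  edge-by-endpoints e f u≢v (inj₁ refl) (inj₁ refl) _ _ = contradiction refl u≢v
  edge-by-endpoints e f u≢v (inj₂ refl) (inj₂ refl) _ _ = contradiction refl u≢v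
  edge-by-endpoints e f u≢v (inj₁ refl) (inj₂ refl) (inj₁ refl) (inj₁ refl) = contradiction refl u≢v
  edge-by-endpoints e f u≢v (inj₁ refl) (inj₂ refl) (inj₁ refl) (inj₂ refl) = edge-ext refl
  edge-by-endpoints e f u≢v (inj₁ refl) (inj₂ refl) (inj₂ refl) (inj₁ refl) =
    contradiction (proj₁ (proj₂ f)) (<-asym (proj₁ (proj₂ e)))
  edge-by-endpoints e f u≢v (inj₁ refl) (inj₂ refl) (inj₂ refl) (inj₂ refl) = contradiction refl u≢v
  edge-by-endpoints e f u≢v (inj₂ refl) (inj₁ refl) (inj₁ refl) (inj₁ refl) = contradiction refl u≢v
  edge-by-endpoints e f u≢v (inj₂ refl) (inj₁ refl) (inj₁ refl) (inj₂ refl) =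
    contradiction (proj₁ (proj₂ f)) (<-asym (proj₁ (proj₂ e)))
  edge-by-endpoints e f u≢v (inj₂ refl) (inj₁ refl) (inj₂ refl) (inj₁ refl) = edge-ext refl
  edge-by-endpoints e f u≢v (inj₂ refl) (inj₁ refl) (inj₂ refl) (inj₂ refl) = contradiction refl u≢v

  adj⇒≢ : ∀ {u v} → Adj G u v → u ≢ v
  adj⇒≢ a refl = irreflexive a

  edgeOf-sym : ∀ {u v} (a : Adj G u v) (b : Adj G v u) → edgeOf a ≡ edgeOf b
  edgeOf-sym a b = edge-by-endpoints _ _ (adj⇒≢ a)
    (proj₁ (edgeOf-endpoints a)) (proj₂ (edgeOf-endpoints a))
    (proj₂ (edgeOf-endpoints b)) (proj₁ (edgeOf-endpoints b))

  sameEdge⁺ : ∀ {u v x y} (a : Adj G u v) (b : Adj G x y) → edgeOf a ≡ edgeOf b → SameEdge u v x y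
  sameEdge⁺ {u} {v} {x} {y} a b eq
    with edgeOf b | edgeOf-endpoints b | subst (λ e → e ∋ₑ u × e ∋ₑ v) eq (edgeOf-endpoints a)
  ... | e | inj₁ refl , inj₁ refl | _                       = contradiction refl (adj⇒≢ b)
  ... | e | inj₂ refl , inj₂ refl | _                       = contradiction refl (adj⇒≢ b)
  ... | e | _                     | inj₁ refl , inj₁ refl   = contradiction refl (adj⇒≢ a)
  ... | e | _                     | inj₂ refl , inj₂ refl   = contradiction refl (adj⇒≢ a)
  ... | e | inj₁ refl , inj₂ refl | inj₁ refl , inj₂ refl   = inj₁ (refl , refl)
  ... | e | inj₁ refl , inj₂ refl | inj₂ refl , inj₁ refl   = inj₂ (refl , refl)
  ... | e | inj₂ refl , inj₁ refl | inj₁ refl , inj₂ refl   = inj₂ (refl , refl)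
  ... | e | inj₂ refl , inj₁ refl | inj₂ refl , inj₁ refl   = inj₁ (refl , refl)

  sameEdge⁻ : (e f : Edge G) → SameEdge (proj₁ (proj₁ e)) (proj₂ (proj₁ e))
                                        (proj₁ (proj₁ f)) (proj₂ (proj₁ f)) → e ≡ f
  sameEdge⁻ e f (inj₁ (refl , refl)) = edge-ext refl
  sameEdge⁻ e f (inj₂ (refl , refl)) =
    contradiction (proj₁ (proj₂ f)) (<-asym (proj₁ (proj₂ e)))

  module _ {A : Set} {L : List A} (P : Palette (Adj G) L) where

    edgeColor : Edge G → A
    edgeColor ((u , v) , _) = color P u v

    private
      orient : ∀ e {a} → e ∋ₑ a → ∃[ b ] Adj G a b × edgeColor e ≡ color P a b ×
               (∀ {x y} → SameEdge a b x y → SameEdge (proj₁ (proj₁ e)) (proj₂ (proj₁ e)) x y)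
      orient (_ , _ , a) (inj₁ refl) = _ , a , refl , id
      orient (_ , _ , a) (inj₂ refl) = _ , adj-symm a , color-sym P a , flipEdge
        where
        flipEdge : ∀ {u v x y : Vertex G} → SameEdge u v x y → SameEdge v u x y
        flipEdge (inj₁ (p , q)) = inj₂ (q , p)
        flipEdge (inj₂ (p , q)) = inj₁ (q , p)

      flip₂ : ∀ {u v x y : Vertex G} → SameEdge u v x y → SameEdge x y u v
      flip₂ (inj₁ (refl , refl)) = inj₁ (refl , refl)
      flip₂ (inj₂ (refl , refl)) = inj₂ (refl , refl)

    -- `strong` compares two edges at their first endpoints. `orient` turns each edge so that the
    -- given endpoint comes first, which `color-sym` allows.
    edgeColor-injective : ∀ e f {a b} → e ∋ₑ a → f ∋ₑ b → a ≡ b ⊎ Adj G a b →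
                          edgeColor e ≡ edgeColor f → e ≡ f
    edgeColor-injective e f e∋a f∋b near eq
      with a′ , r , p , back ← orient e e∋a | b′ , r′ , p′ , back′ ← orient f f∋b =
      sameEdge⁻ e f (flip₂ (back′ (flip₂ (back
        (strong P r r′ near (trans (sym p) (trans eq p′)))))))

    palette⇒colorable : StronglyEdgeColorable G (length L)
    palette⇒colorable = c , proper , far
      where
      c : Edge G → Fin (length L)
      c e = index (in-palette P (proj₂ (proj₂ e)))
      c-injective : ∀ e f → c e ≡ c f → edgeColor e ≡ edgeColor f
      c-injective e f eq = trans (lookup-index (in-palette P (proj₂ (proj₂ e))))
        (trans (cong (List.lookup L) eq)
               (sym (lookup-index (in-palette P (proj₂ (proj₂ f))))))
      proper : ProperColoring (EdgeAdj G) c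
      proper e f (e≢f , w , p , q) eq =
        e≢f (edgeColor-injective e f p q (inj₁ refl) (c-injective e f eq))
      join-endpoints : ∀ e {w w′} → e ∋ₑ w → e ∋ₑ w′ → w ≡ w′ ⊎ Adj G w w′
      join-endpoints _           (inj₁ refl) (inj₁ refl) = inj₁ refl
      join-endpoints (_ , _ , a) (inj₁ refl) (inj₂ refl) = inj₂ a
      join-endpoints (_ , _ , a) (inj₂ refl) (inj₁ refl) = inj₂ (adj-symm a)
      join-endpoints _           (inj₂ refl) (inj₂ refl) = inj₁ refl
      far : ∀ e f g → f ≢ g → EdgeAdj G e f → EdgeAdj G e g → c f ≢ c g
      far e f g f≢g (_ , w , p , q) (_ , w′ , p′ , q′) eq =
        f≢g (edgeColor-injective f g q q′ (join-endpoints e p p′) (c-injective f g eq))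

  colorable⇒palette : ∀ {k} → StronglyEdgeColorable G k → Palette (Adj G) (upTo k)
  colorable⇒palette {k} (c , proper , far) = record
    { color      = col
    ; color-sym  = λ a → trans (col-adj a) (trans (cong (toℕ ∘ c) (edgeOf-sym a (adj-symm a)))
                                                  (sym (col-adj (adj-symm a))))
    ; in-palette = λ a → subst (_∈ upTo k) (sym (col-adj a)) (∈-upTo⁺ (toℕ<n (c (edgeOf a))))
    ; strong     = λ a b near eq → sameEdge⁺ a b (c-strong a b near
                     (toℕ-injective (trans (sym (col-adj a)) (trans eq (col-adj b)))))
    }
    where
    col : Vertex G → Vertex G → ℕ
    col u v with T? (adj G u v)
    ... | yes a = toℕ (c (edgeOf a))
    -- A default value: the laws of a palette assume adjacency, where `col-adj` yields the color of
    -- the edge.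
    ... | no  _ = 0
    col-adj : ∀ {u v} (a : Adj G u v) → col u v ≡ toℕ (c (edgeOf a))
    col-adj {u} {v} a with T? (adj G u v)
    ... | yes b = cong (toℕ ∘ c ∘ edgeOf) (T-irrelevant b a)
    ... | no ¬a = contradiction a ¬a
    c-strong : ∀ {u v x y} (a : Adj G u v) (b : Adj G x y) → u ≡ x ⊎ Adj G u x →
               c (edgeOf a) ≡ c (edgeOf b) → edgeOf a ≡ edgeOf b
    c-strong a b near eq with edgeOf a ≟ₑ edgeOf b
    ... | yes e≡f = e≡f
    c-strong a b (inj₁ refl) eq | no e≢f = contradiction eq (proper _ _
      (e≢f , _ , proj₁ (edgeOf-endpoints a) , proj₁ (edgeOf-endpoints b)))
    -- `edgeOf r` is the middle edge for `far`, which asks that it differ from both edges; if it is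
    -- one of them, they already share an endpoint.
    c-strong {u} {v} {x} {y} a b (inj₂ r) eq | no e≢f
      with edgeOf r ≟ₑ edgeOf a | edgeOf r ≟ₑ edgeOf b
    ... | yes g≡e | _ = contradiction eq (proper _ _
      (e≢f , x , subst (_∋ₑ x) g≡e (proj₂ (edgeOf-endpoints r)) , proj₁ (edgeOf-endpoints b)))
    ... | _ | yes g≡f = contradiction eq (proper _ _
      (e≢f , u , proj₁ (edgeOf-endpoints a) , subst (_∋ₑ u) g≡f (proj₁ (edgeOf-endpoints r))))
    ... | no g≢e | no g≢f = contradiction eq (far (edgeOf r) _ _ e≢f
      (g≢e , u , proj₁ (edgeOf-endpoints r) , proj₁ (edgeOf-endpoints a))
      (g≢f , x , proj₂ (edgeOf-endpoints r) , proj₁ (edgeOf-endpoints b)))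

record Optimal (G : Graph) (k : ℕ) : Set where
  field
    attained : Palette (Adj G) (upTo k)
    minimal  : ∀ {j} → Palette (Adj G) (upTo j) → k ≤ j

open Optimal

-- A round trip through colorings by `Fin` replaces each color by its position in `L`. Thus palettes
-- over tagged colors, over edges or over a subset of the numbers can be compared with `minimal`,
-- which speaks of `upTo j`.
normalize : ∀ {G} {A : Set} {L : List A} → Palette (Adj G) L → Palette (Adj G) (upTo (length L))
normalize {G} P = colorable⇒palette {G} (palette⇒colorable {G} P)

optimal : ∀ {G k} {A : Set} {L : List A} → Palette (Adj G) L → length L ≡ k →
          (∀ {j} → Palette (Adj G) (upTo j) → k ≤ j) → Optimal G k
optimal {G} P refl min = record { attained = normalize {G} P ; minimal = min }

optimal⇒index : ∀ {G k} → Optimal G k → IsStrongChromaticIndex G k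
optimal⇒index {G} {k} o =
  subst (StronglyEdgeColorable G) (length-upTo k) (palette⇒colorable {G} (attained o)) ,
  λ j c → minimal o (colorable⇒palette {G} c)

-- Unions and joins

module _ (b : Bool) (G H : Graph) where

  private
    m = order G
    n = order H

  splitAt-injective : ∀ {i j} → splitAt m {n} i ≡ splitAt m j → i ≡ j
  splitAt-injective {i} {j} eq =
    trans (sym (Fin.join-splitAt m n i)) (trans (cong (Fin.join m n) eq) (Fin.join-splitAt m n j))

  -- On `Vertex G ⊎ Vertex H` colorings can be defined by matching on the sides; `splitAt` carries
  -- them over to the numbered vertices.
  fromSum : {A : Set} {L : List A} →
            Palette (λ x y → T (sumAdj b G H x y)) L → Palette (Adj (sumGraph b G H)) L
  fromSum = pullback (splitAt m) splitAt-injective id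

  toSum : {A : Set} {L : List A} →
          Palette (Adj (sumGraph b G H)) L → Palette (λ x y → T (sumAdj b G H x y)) L
  toSum = pullback (Fin.join m n)
    (λ {x} {y} eq → trans (sym (Fin.splitAt-join m n x))
                      (trans (cong (splitAt m) eq) (Fin.splitAt-join m n y)))
    (λ {x} {y} → subst₂ (λ x y → T (sumAdj b G H x y))
                   (sym (Fin.splitAt-join m n x)) (sym (Fin.splitAt-join m n y)))

module _ {G H : Graph} {k l : ℕ} (oG : Optimal G k) (oH : Optimal H l) where

  private
    lift₁ : {u v x y : Vertex G} → SameEdge u v x y →
            SameEdge {Vertex G ⊎ Vertex H} (inj₁ u) (inj₁ v) (inj₁ x) (inj₁ y)
    lift₁ (inj₁ (refl , refl)) = inj₁ (refl , refl)
    lift₁ (inj₂ (refl , refl)) = inj₂ (refl , refl)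
    lift₂ : {u v x y : Vertex H} → SameEdge u v x y →
            SameEdge {Vertex G ⊎ Vertex H} (inj₂ u) (inj₂ v) (inj₂ x) (inj₂ y)
    lift₂ (inj₁ (refl , refl)) = inj₁ (refl , refl)
    lift₂ (inj₂ (refl , refl)) = inj₂ (refl , refl)
    drop₁ : {u x : Vertex G} {R : Set} → inj₁ {B = Vertex H} u ≡ inj₁ x ⊎ R → u ≡ x ⊎ R
    drop₁ (inj₁ refl) = inj₁ refl
    drop₁ (inj₂ r)    = inj₂ r
    drop₂ : {u x : Vertex H} {R : Set} → inj₂ {A = Vertex G} u ≡ inj₂ x ⊎ R → u ≡ x ⊎ R
    drop₂ (inj₁ refl) = inj₁ refl
    drop₂ (inj₂ r)    = inj₂ r

  -- No edge links the two sides, so they may share their colors, and each side alone already forces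
  -- its own index. The maximum is written as one subtraction and one addition of the machine
  -- compute it.
  disjointUnion-optimal : Optimal (disjointUnion G H) (l + (k ∸ l))
  disjointUnion-optimal = optimal {disjointUnion G H} (fromSum false G H P) (length-upTo K) least
    where
    K = l + (k ∸ l)
    cG = attained oG
    cH = attained oH
    k≤K : k ≤ K
    k≤K = m≤n+m∸n k l
    l≤K : l ≤ K
    l≤K = m≤m+n l (k ∸ l)
    R : Vertex G ⊎ Vertex H → Vertex G ⊎ Vertex H → Set
    R x y = T (sumAdj false G H x y)
    grow : ∀ {j c} → j ≤ K → c ∈ upTo j → c ∈ upTo K
    grow j≤K c∈ = ∈-upTo⁺ (<-≤-trans (∈-upTo⁻ c∈) j≤K)
    P : Palette R (upTo K)
    P = record
      { color      = col
      ; color-sym  = λ {x} {y} → col-sym x y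
      ; in-palette = λ {x} {y} → col-in x y
      ; strong     = λ {x} {y} {z} {w} → col-strong x y z w
      }
      where
      col : Vertex G ⊎ Vertex H → Vertex G ⊎ Vertex H → ℕ
      col (inj₁ u) (inj₁ v) = color cG u v
      col (inj₂ u) (inj₂ v) = color cH u v
      -- A default for pairs on different sides, which a union leaves non-adjacent.
      col _        _        = 0
      col-sym : ∀ x y → R x y → col x y ≡ col y x
      col-sym (inj₁ _) (inj₁ _) = color-sym cG
      col-sym (inj₂ _) (inj₂ _) = color-sym cH
      col-in : ∀ x y → R x y → col x y ∈ upTo K
      col-in (inj₁ _) (inj₁ _) a = grow k≤K (in-palette cG a)
      col-in (inj₂ _) (inj₂ _) a = grow l≤K (in-palette cH a)
      col-strong : ∀ x y z w → R x y → R z w → x ≡ z ⊎ R x z → col x y ≡ col z w → SameEdge x y z w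
      col-strong (inj₁ _) (inj₁ _) (inj₁ _) (inj₁ _) a b near eq =
        lift₁ (strong cG a b (drop₁ near) eq)
      col-strong (inj₂ _) (inj₂ _) (inj₂ _) (inj₂ _) a b near eq =
        lift₂ (strong cH a b (drop₂ near) eq)
      col-strong (inj₁ _) (inj₁ _) (inj₂ _) (inj₂ _) a b (inj₁ ()) eq
      col-strong (inj₁ _) (inj₁ _) (inj₂ _) (inj₂ _) a b (inj₂ ()) eq
      col-strong (inj₂ _) (inj₂ _) (inj₁ _) (inj₁ _) a b (inj₁ ()) eq
      col-strong (inj₂ _) (inj₂ _) (inj₁ _) (inj₁ _) a b (inj₂ ()) eq
    least : ∀ {j} → Palette (Adj (disjointUnion G H)) (upTo j) → K ≤ j
    least {j} Q = [ (λ k≤l → subst (_≤ j) (sym (trans (cong (l +_) (m≤n⇒m∸n≡0 k≤l)) (+-identityʳ l))) l≤j)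
                  , (λ l≤k → subst (_≤ j) (sym (m+[n∸m]≡n l≤k)) k≤j) ]′ (≤-total k l)
      where
      Q′ = toSum false G H Q
      k≤j : k ≤ j
      k≤j = minimal oG (pullback {R = Adj G} inj₁ (λ { refl → refl }) id Q′)
      l≤j : l ≤ j
      l≤j = minimal oH (pullback {R = Adj H} inj₂ (λ { refl → refl }) id Q′)

  join-optimal : Optimal (join G H) (k + l + order G * order H)
  join-optimal = optimal {join G H} (fromSum true G H P) length-L least
    where
    cG = attained oG
    cH = attained oH
    R : Vertex G ⊎ Vertex H → Vertex G ⊎ Vertex H → Set
    R x y = T (sumAdj true G H x y)
    -- One sort of colors for either side and one for the cross edges, each of which is its own
    -- color; the tags keep the sorts disjoint.
    Colors = (ℕ ⊎ ℕ) ⊎ (Vertex G × Vertex H)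
    cross = cartesianProduct (allFin (order G)) (allFin (order H))
    length-cross : length cross ≡ order G * order H
    length-cross = length-grid (order G) (order H)
    ∈-cross : ∀ u v → (u , v) ∈ cross
    ∈-cross u v = ∈-cartesianProduct⁺ (∈-allFin u) (∈-allFin v)
    L₁ L₂ L₃ : List Colors
    L₁ = map (λ c → inj₁ (inj₁ c)) (upTo k)
    L₂ = map (λ c → inj₁ (inj₂ c)) (upTo l)
    L₃ = map inj₂ cross
    length-L : length ((L₁ ++ L₂) ++ L₃) ≡ k + l + order G * order H
    length-L = trans (length-++ (L₁ ++ L₂)) (cong₂ _+_
      (trans (length-++ L₁) (cong₂ _+_ (trans (length-map _ (upTo k)) (length-upTo k))
                                       (trans (length-map _ (upTo l)) (length-upTo l))))
      (trans (length-map inj₂ cross) length-cross))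
    P : Palette R ((L₁ ++ L₂) ++ L₃)
    P = record
      { color      = col
      ; color-sym  = λ {x} {y} → col-sym x y
      ; in-palette = λ {x} {y} → col-in x y
      ; strong     = λ {x} {y} {z} {w} → col-strong x y z w
      }
      where
      col : Vertex G ⊎ Vertex H → Vertex G ⊎ Vertex H → Colors
      col (inj₁ u) (inj₁ v) = inj₁ (inj₁ (color cG u v))
      col (inj₂ u) (inj₂ v) = inj₁ (inj₂ (color cH u v))
      col (inj₁ u) (inj₂ v) = inj₂ (u , v)
      col (inj₂ v) (inj₁ u) = inj₂ (u , v)
      col-sym : ∀ x y → R x y → col x y ≡ col y x
      col-sym (inj₁ _) (inj₁ _) a = cong (inj₁ ∘ inj₁) (color-sym cG a)
      col-sym (inj₂ _) (inj₂ _) a = cong (inj₁ ∘ inj₂) (color-sym cH a)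
      col-sym (inj₁ _) (inj₂ _) _ = refl
      col-sym (inj₂ _) (inj₁ _) _ = refl
      col-in : ∀ x y → R x y → col x y ∈ (L₁ ++ L₂) ++ L₃
      col-in (inj₁ _) (inj₁ _) a = ∈-++⁺ˡ (∈-++⁺ˡ (∈-map⁺ _ (in-palette cG a)))
      col-in (inj₂ _) (inj₂ _) a = ∈-++⁺ˡ (∈-++⁺ʳ L₁ (∈-map⁺ _ (in-palette cH a)))
      col-in (inj₁ u) (inj₂ v) _ = ∈-++⁺ʳ (L₁ ++ L₂) (∈-map⁺ inj₂ (∈-cross u v))
      col-in (inj₂ v) (inj₁ u) _ = ∈-++⁺ʳ (L₁ ++ L₂) (∈-map⁺ inj₂ (∈-cross u v))
      inj₁₁-injective : ∀ {c d} → _≡_ {A = Colors} (inj₁ (inj₁ c)) (inj₁ (inj₁ d)) → c ≡ d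
      inj₁₁-injective refl = refl
      inj₁₂-injective : ∀ {c d} → _≡_ {A = Colors} (inj₁ (inj₂ c)) (inj₁ (inj₂ d)) → c ≡ d
      inj₁₂-injective refl = refl
      col-strong : ∀ x y z w → R x y → R z w → x ≡ z ⊎ R x z → col x y ≡ col z w → SameEdge x y z w
      col-strong (inj₁ _) (inj₁ _) (inj₁ _) (inj₁ _) a b near eq =
        lift₁ (strong cG a b (drop₁ near) (inj₁₁-injective eq))
      col-strong (inj₂ _) (inj₂ _) (inj₂ _) (inj₂ _) a b near eq =
        lift₂ (strong cH a b (drop₂ near) (inj₁₂-injective eq))
      col-strong (inj₁ _) (inj₁ _) (inj₁ _) (inj₂ _) a b near ()
      col-strong (inj₁ _) (inj₁ _) (inj₂ _) (inj₂ _) a b near ()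
      col-strong (inj₁ _) (inj₁ _) (inj₂ _) (inj₁ _) a b near ()
      col-strong (inj₂ _) (inj₂ _) (inj₁ _) (inj₂ _) a b near ()
      col-strong (inj₂ _) (inj₂ _) (inj₂ _) (inj₁ _) a b near ()
      col-strong (inj₂ _) (inj₂ _) (inj₁ _) (inj₁ _) a b near ()
      col-strong (inj₁ _) (inj₂ _) (inj₁ _) (inj₂ _) a b near refl = inj₁ (refl , refl)
      col-strong (inj₁ _) (inj₂ _) (inj₂ _) (inj₁ _) a b near refl = inj₂ (refl , refl)
      col-strong (inj₂ _) (inj₁ _) (inj₁ _) (inj₂ _) a b near refl = inj₂ (refl , refl)
      col-strong (inj₂ _) (inj₁ _) (inj₂ _) (inj₁ _) a b near refl = inj₁ (refl , refl)
    least : ∀ {j} → Palette (Adj (join G H)) (upTo j) → k + l + order G * order H ≤ j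
    least {j} Q = begin
      k + l + order G * order H          ≤⟨ +-mono-≤ (+-mono-≤ k≤ l≤) (≤-reflexive (sym length-X)) ⟩
      length UG + length UH + length X   ≡⟨ cong (_+ length X) (length-++ UG) ⟨
      length (UG ++ UH) + length X       ≡⟨ length-++ (UG ++ UH) ⟨
      length ((UG ++ UH) ++ X)           ≤⟨ unique-⊆-length unique inside ⟩
      length (upTo j)                    ≡⟨ length-upTo j ⟩
      j                                  ∎
      where
      open ≤-Reasoning
      Q′ = toSum true G H Q
      QG : Palette (Adj G) (upTo j)
      QG = pullback inj₁ (λ { refl → refl }) id Q′
      QH : Palette (Adj H) (upTo j)
      QH = pullback inj₂ (λ { refl → refl }) id Q′
      Used : (F : Graph) → Palette (Adj F) (upTo j) → ℕ → Set
      Used F q c = ∃[ u ] ∃[ v ] Adj F u v × color q u v ≡ c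
      used? : ∀ F q c → Dec (Used F q c)
      used? F q c = any? λ u → any? λ v → T? (adj F u v) ×-dec color q u v ℕ.≟ c
      used : (F : Graph) → Palette (Adj F) (upTo j) → List ℕ
      used F q = filter (used? F q) (upTo j)
      -- On the full palette `minimal` would only give `k ≤ j` and `l ≤ j`. Counting the colors that
      -- really occur on each side gives lower bounds for disjoint sets, which can be added.
      restrict : ∀ F q → Palette (Adj F) (used F q)
      restrict F q = record
        { color      = color q
        ; color-sym  = color-sym q
        ; in-palette = λ a → ∈-filter⁺ (used? F q) (in-palette q a) (_ , _ , a , refl)
        ; strong     = strong q
        }
      used⁻ : ∀ F q {c} → c ∈ used F q → c ∈ upTo j × Used F q c
      used⁻ F q = ∈-filter⁻ (used? F q)
      crossColor : Vertex G × Vertex H → ℕ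
      crossColor (u , v) = color Q′ (inj₁ u) (inj₂ v)
      UG = used G QG
      UH = used H QH
      X  = map crossColor cross
      k≤ : k ≤ length UG
      k≤ = minimal oG (normalize {G} (restrict G QG))
      l≤ : l ≤ length UH
      l≤ = minimal oH (normalize {H} (restrict H QH))
      length-X : length X ≡ order G * order H
      length-X = trans (length-map crossColor cross) length-cross
      near-absurd : ∀ {u v : Vertex G} {x y : Vertex H} →
                    ¬ SameEdge {Vertex G ⊎ Vertex H} (inj₁ u) (inj₁ v) (inj₂ x) (inj₂ y)
      near-absurd (inj₁ (() , _))
      near-absurd (inj₂ (() , _))
      unique : Unique ((UG ++ UH) ++ X)
      unique = Unique.++⁺
        (Unique.++⁺ (Unique.filter⁺ (used? G QG) (Unique.upTo⁺ j))
                    (Unique.filter⁺ (used? H QH) (Unique.upTo⁺ j)) G-H)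
        (unique-map crossColor crossColor-injective
          (Unique.cartesianProduct⁺ (Unique.allFin⁺ _) (Unique.allFin⁺ _)))
        GH-X
        where
        G-H : ∀ {c} → ¬ (c ∈ UG × c ∈ UH)
        G-H (p , q) with _ , u , v , a , refl ← used⁻ G QG p | _ , x , y , b , eq ← used⁻ H QH q =
          near-absurd (strong Q′ {inj₁ u} {inj₁ v} {inj₂ x} {inj₂ y} a b (inj₂ tt) (sym eq))
        crossColor-injective : ∀ {e f} → e ∈ cross → f ∈ cross → crossColor e ≡ crossColor f → e ≡ f
        crossColor-injective {u , v} {x , y} _ _ eq
          -- The second edge is read from its end in `H`, so that its first endpoint is adjacent to
          -- `inj₁ u`.
          with strong Q′ {inj₁ u} {inj₂ v} {inj₂ y} {inj₁ x} tt tt (inj₂ tt)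
                 (trans eq (color-sym Q′ {inj₁ x} {inj₂ y} tt))
        ... | inj₂ (refl , refl) = refl
        GH-X : ∀ {c} → ¬ (c ∈ UG ++ UH × c ∈ X)
        GH-X (p , q) with ∈-map⁻ crossColor q
        GH-X (p , q) | (x , y) , _ , eq with ∈-++⁻ UG p
        ... | inj₁ p′ with _ , u , v , a , refl ← used⁻ G QG p′
          with strong Q′ {inj₁ u} {inj₁ v} {inj₂ y} {inj₁ x} a tt (inj₂ tt)
                 (trans eq (color-sym Q′ {inj₁ x} {inj₂ y} tt))
        ... | inj₁ (() , _)
        ... | inj₂ (_ , ())
        GH-X (p , q) | (x , y) , _ , eq | inj₂ p′ with _ , u , v , a , refl ← used⁻ H QH p′
          with strong Q′ {inj₂ u} {inj₂ v} {inj₁ x} {inj₂ y} a tt (inj₂ tt) eq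
        ... | inj₁ (() , _)
        ... | inj₂ (_ , ())
      inside : ∀ {c} → c ∈ (UG ++ UH) ++ X → c ∈ upTo j
      inside p with ∈-++⁻ (UG ++ UH) p
      ... | inj₂ q with (x , y) , _ , refl ← ∈-map⁻ crossColor q = in-palette Q′ {inj₁ x} {inj₂ y} tt
      ... | inj₁ q with ∈-++⁻ UG q
      ...   | inj₁ r = proj₁ (used⁻ G QG r)
      ...   | inj₂ r = proj₁ (used⁻ H QH r)

≅-optimal : ∀ {G H k} → G ≅ H → Optimal G k → Optimal H k
≅-optimal {G} {H} {k} i o = record
  { attained = pullback from from-injective (λ {u} {v} → from-hom u v) (attained o)
  ; minimal  = λ P → minimal o (pullback to to-injective (λ {u} {v} → to-hom u v) P)
  }
  where
  open _≅_ i
  open Inverse bijection using (to; from; strictlyInverseˡ; strictlyInverseʳ)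
  to-injective : ∀ {u v} → to u ≡ to v → u ≡ v
  to-injective {u} {v} eq = trans (sym (strictlyInverseʳ u)) (trans (cong from eq) (strictlyInverseʳ v))
  from-injective : ∀ {u v} → from u ≡ from v → u ≡ v
  from-injective {u} {v} eq = trans (sym (strictlyInverseˡ u)) (trans (cong to eq) (strictlyInverseˡ v))
  to-hom : ∀ u v → Adj G u v → Adj H (to u) (to v)
  to-hom u v = subst T (preserves u v)
  from-hom : ∀ u v → Adj H u v → Adj G (from u) (from v)
  from-hom u v a = subst T (sym (preserves (from u) (from v)))
    (subst₂ (Adj H) (sym (strictlyInverseˡ u)) (sym (strictlyInverseˡ v)) a)

-- Forests

module _ {n : ℕ} {R : Fin n → Fin n → Set} (R? : ∀ u v → Dec (R u v))
         (R-sym : ∀ {u v} → R u v → R v u) (R-irrefl : ∀ {v} → ¬ R v v)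
         (acyclic : ∀ v vs → ¬ Cycle R v vs) where

  open import Data.List.Membership.DecPropositional (_≟_ {n}) using (_∈?_)

  private
    Path : List (Fin n) → Set
    Path vs = Unique vs × Linked R vs

    prefix-unique : ∀ {A : Set} (as : List A) {z bs} → Unique (as ++ z ∷ bs) → Unique (as ++ [ z ])
    prefix-unique []       (_ ∷ _) = [] ∷ []
    prefix-unique (a ∷ as) {z} {bs} u@(_ ∷ u′) = unique-∷ a∉ (prefix-unique as u′)
      where
      a∉ : a ∉ as ++ [ z ]
      a∉ p with ∈-++⁻ as p
      ... | inj₁ q           = Unique.Unique[x∷xs]⇒x∉xs u (∈-++⁺ˡ q)
      ... | inj₂ (here refl) = Unique.Unique[x∷xs]⇒x∉xs u (∈-++⁺ʳ as (here refl))

    prefix-linked : ∀ {w} (as : List (Fin n)) {z bs} → Linked R (as ++ z ∷ bs) → R z w →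
                    Linked R ((as ++ [ z ]) ++ [ w ])
    prefix-linked []           l       r = r ∷ [-]
    prefix-linked (a ∷ [])     (s ∷ l) r = s ∷ prefix-linked [] l r
    prefix-linked (a ∷ b ∷ as) (s ∷ l) r = s ∷ prefix-linked (b ∷ as) l r

    -- The stretch of the path from `a` to `z` would close to a cycle. As `z` lies beyond `b`, that
    -- cycle has at least three vertices.
    no-chord : ∀ {a b ps z} → Path (a ∷ b ∷ ps) → R a z → z ∉ ps
    no-chord {a} {b} (u , l) r z∈ with as , bs , refl ← ∈-∃++ z∈ =
      acyclic a (b ∷ as ++ [ _ ])
        ( s≤s (subst (1 ≤_) (sym (length-++ as)) (m≤n+m 1 (length as)))
        , prefix-unique (a ∷ b ∷ as) u , prefix-linked (a ∷ b ∷ as) l (R-sym r))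

  -- `q` is the one neighbor of `p` that may have further neighbors. If all neighbors of `p` are
  -- leaves, `q` may be `y` itself.
  record LeafStar : Set where
    field
      p q y   : Fin n
      p-q     : R p q
      p-y     : R p y
      y-leaf  : ∀ {z} → R y z → z ≡ p
      p-leaves : ∀ {x} → R p x → x ≢ q → ∀ {z} → R x z → z ≡ p

  private
    -- The path is prolonged at its head p as long as some neighbor of p off
    -- the path is not a leaf.
    search : (fuel : ℕ) → ∀ p ps {y} → length (p ∷ ps) + fuel ≡ suc n →
             Path (p ∷ ps) → R p y → y ∉ ps → LeafStar
    -- Out of fuel, the path would have `n + 1` distinct vertices.
    search zero p ps len (u , _) _ _ = contradiction
      (≤-trans (≤-reflexive (trans (sym len) (+-identityʳ _)))
        (≤-trans (unique-⊆-length u (λ _ → ∈-allFin _)) (≤-reflexive (length-tabulate {n = n} id))))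
      (n≮n n)
    search (suc fuel) p ps {y} len path@(u , l) p-y y∉
      with any? (λ x → R? p x ×-dec ¬? (x ∈? ps) ×-dec any? (λ z → R? x z ×-dec ¬? (z ≟ p)))
    ... | yes (x , p-x , x∉ , z , x-z , z≢p) =
      search fuel x (p ∷ ps) (trans (sym (+-suc _ fuel)) len) path′ x-z z∉
      where
      path′ : Path (x ∷ p ∷ ps)
      path′ = unique-∷ (λ { (here refl) → R-irrefl p-x ; (there x∈) → x∉ x∈ }) u , R-sym p-x ∷ l
      z∉ : z ∉ p ∷ ps
      z∉ (here z≡p) = z≢p z≡p
      z∉ (there z∈) = no-chord path′ x-z z∈
    ... | no none = finish ps path y∉ leaf
      where
      leaf : ∀ {x} → R p x → x ∉ ps → ∀ {z} → R x z → z ≡ p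
      leaf {x} p-x x∉ {z} x-z with z ≟ p
      ... | yes z≡p = z≡p
      ... | no z≢p  = contradiction (x , p-x , x∉ , z , x-z , z≢p) none
      finish : ∀ ps → Path (p ∷ ps) → y ∉ ps →
               (∀ {x} → R p x → x ∉ ps → ∀ {z} → R x z → z ≡ p) → LeafStar
      finish [] _ _ leaf = record
        { p-q = p-y ; p-y = p-y ; y-leaf = leaf p-y (λ ()) ; p-leaves = λ p-x _ → leaf p-x (λ ()) }
      finish (q ∷ ps) path@(_ , p-q ∷ _) y∉ leaf = record
        { p-q = p-q ; p-y = p-y ; y-leaf = leaf p-y y∉
        -- With `q` the predecessor of `p` on the path, any other neighbor of `p` is off the path,
        -- since it would give a chord.
        ; p-leaves = λ p-x x≢q → leaf p-x λ { (here x≡q) → x≢q x≡q ; (there x∈) → no-chord path p-x x∈ } }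

  leafStar : ∀ {u v} → R u v → LeafStar
  leafStar {u} r = search n u [] refl ([] ∷ [] , [-]) r (λ ())

module _ {n : ℕ} where

  private
    E = Fin n × Fin n

  open import Data.List.Membership.DecPropositional (≡-dec (_≟_ {n}) (_≟_ {n})) using (_∈?_)

  Joined : List E → Fin n → Fin n → Set
  Joined es u v = (u , v) ∈ es ⊎ (v , u) ∈ es

  joined? : ∀ es u v → Dec (Joined es u v)
  joined? es u v = ((u , v) ∈? es) ⊎-dec ((v , u) ∈? es)

  joined-sym : ∀ {es u v} → Joined es u v → Joined es v u
  joined-sym (inj₁ r) = inj₂ r
  joined-sym (inj₂ r) = inj₁ r

  Incident : Fin n → E → Set
  Incident w (u , v) = w ≡ u ⊎ w ≡ v

  incident? : ∀ w e → Dec (Incident w e)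
  incident? w (u , v) = (w ≟ u) ⊎-dec (w ≟ v)

  incidents : Fin n → List E → List E
  incidents w = filter (incident? w)

  degree : Fin n → List E → ℕ
  degree w es = length (incidents w es)

  -- Removing a leaf edge leaves its endpoint `y` as an isolated vertex, so the invariant of the
  -- induction must not ask for connectedness. With `ordered` and `unique` every edge is listed once
  -- and in one direction.
  record IsForest (es : List E) : Set where
    field
      ordered  : ∀ {u v} → (u , v) ∈ es → u <ᶠ v
      unique   : Unique es
      acyclic  : ∀ v vs → ¬ Cycle (Joined es) v vs

  sameEdge? : (u v x y : Fin n) → Dec (SameEdge u v x y)
  sameEdge? u v x y = ((u ≟ x) ×-dec (v ≟ y)) ⊎-dec ((u ≟ y) ×-dec (v ≟ x))

  -- A leaf edge yp such that every other edge conflicting with it meets p or q.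
  record LeafEdge (es : List E) : Set where
    field
      p q y    : Fin n
      e g      : E
      es′      : List E
      split    : es ↭ e ∷ es′
      forest′  : IsForest es′
      e-ends   : Joined [ e ] p y
      g-ends   : Joined [ g ] p q
      g∈       : g ∈ es
      isolated : ∀ {z} → ¬ Joined es′ y z
      y-leaf   : ∀ {z} → Joined es y z → z ≡ p
      p-leaves : ∀ {x} → Joined es p x → x ≢ q → ∀ {z} → Joined es x z → z ≡ p

  joined-map : ∀ {es fs} → (∀ {e} → e ∈ es → e ∈ fs) → ∀ {u v} → Joined es u v → Joined fs u v
  joined-map keep (inj₁ r) = inj₁ (keep r)
  joined-map keep (inj₂ r) = inj₂ (keep r)

  incident-ends : ∀ {u v e} → Joined [ e ] u v → Incident u e × Incident v e
  incident-ends (inj₁ (here refl)) = inj₁ refl , inj₂ refl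
  incident-ends (inj₂ (here refl)) = inj₂ refl , inj₁ refl

  private
    -- One direction of `e` is excluded from `es′` by uniqueness, the other by the order of
    -- endpoints. Hence `y`, whose only neighbor was `p`, becomes isolated.
    removed : ∀ {es es′ e u v} → (∀ {u v} → (u , v) ∈ es → u <ᶠ v) →
              (∀ {f} → f ∈ es′ → f ∈ es) → e ∈ es → e ∉ es′ →
              Joined [ e ] u v → ¬ Joined es′ v u
    removed ordered keep e∈ e∉ (inj₁ (here refl)) (inj₁ a) = <-asym (ordered (keep a)) (ordered e∈)
    removed ordered keep e∈ e∉ (inj₂ (here refl)) (inj₁ a) = e∉ a
    removed ordered keep e∈ e∉ (inj₁ (here refl)) (inj₂ a) = e∉ a
    removed ordered keep e∈ e∉ (inj₂ (here refl)) (inj₂ a) = <-asym (ordered (keep a)) (ordered e∈)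

  leafEdge : ∀ {es u v} → IsForest es → Joined es u v → LeafEdge es
  leafEdge {es} f r = result (pick p-y) (pick p-q)
    where
    open IsForest f
    irrefl : ∀ {v} → ¬ Joined es v v
    irrefl (inj₁ r) = <-irrefl refl (ordered r)
    irrefl (inj₂ r) = <-irrefl refl (ordered r)
    open LeafStar (leafStar (joined? es) joined-sym irrefl acyclic r)
    pick : ∀ {u v} → Joined es u v → ∃[ e ] e ∈ es × Joined [ e ] u v
    pick (inj₁ r) = _ , r , inj₁ (here refl)
    pick (inj₂ r) = _ , r , inj₂ (here refl)
    result : (∃[ e ] e ∈ es × Joined [ e ] p y) → (∃[ g ] g ∈ es × Joined [ g ] p q) → LeafEdge es
    result (e , e∈ , e-ends) (g , g∈ , g-ends) with as , bs , refl ← ∈-∃++ e∈ = record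
      { split = shift e as bs ; forest′ = forest′ ; e-ends = e-ends ; g-ends = g-ends ; g∈ = g∈
      ; isolated = isolated ; y-leaf = y-leaf ; p-leaves = p-leaves }
      where
      es′ = as ++ bs
      u′ : Unique (e ∷ es′)
      u′ = unique-↭ (shift e as bs) unique
      keep : ∀ {f} → f ∈ es′ → f ∈ es
      keep f∈ = ∈-resp-↭ (↭-sym (shift e as bs)) (there f∈)
      forest′ : IsForest es′
      forest′ = record
        { ordered = λ f∈ → ordered (keep f∈)
        ; unique  = AllPairs.tail u′
        ; acyclic = λ v vs (len , u , l) → acyclic v vs (len , u , Linked.map (joined-map keep) l)
        }
      isolated : ∀ {z} → ¬ Joined es′ y z
      isolated j with refl ← y-leaf (joined-map keep j) =
        removed ordered keep e∈ (Unique.Unique[x∷xs]⇒x∉xs u′) e-ends j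

  private
    edgeless : ∀ {k} → Palette (Joined []) (upTo k)
    edgeless = record
      { color = λ _ _ → 0 ; color-sym = λ { (inj₁ ()) ; (inj₂ ()) }
      ; in-palette = λ { (inj₁ ()) ; (inj₂ ()) } ; strong = λ { (inj₁ ()) ; (inj₂ ()) } }

  -- Distinct leaves witness the successive removal of leaf edges.
  forest-leaves : ∀ m es → length es ≡ m → IsForest es →
                  ∃[ ys ] Unique ys × length ys ≡ m × (∀ {y} → y ∈ ys → ∃[ z ] Joined es y z)
  forest-leaves zero    []       refl _ = [] , [] , refl , λ ()
  forest-leaves (suc m) (f ∷ fs) len forest =
    y ∷ proj₁ ih ,
    unique-∷ (λ y∈ → isolated (proj₂ (non-isolated y∈))) (proj₁ (proj₂ ih)) ,
    cong suc (proj₁ (proj₂ (proj₂ ih))) , non-isolated′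
    where
    open LeafEdge (leafEdge forest (inj₁ (here refl)))
    ih = forest-leaves m es′ (suc-injective (trans (sym (↭-length split)) len)) forest′
    non-isolated = proj₂ (proj₂ (proj₂ ih))
    keep : ∀ {h} → h ∈ e ∷ es′ → h ∈ f ∷ fs
    keep = ∈-resp-↭ (↭-sym split)
    lift : ∀ {u v} → Joined [ e ] u v → Joined (f ∷ fs) u v
    lift = joined-map λ { (here refl) → keep (here refl) }
    non-isolated′ : ∀ {x} → x ∈ y ∷ proj₁ ih → ∃[ z ] Joined (f ∷ fs) x z
    non-isolated′ (here refl) = p , lift (joined-sym e-ends)
    non-isolated′ (there x∈)  = let z , j = non-isolated x∈ in z , joined-map (keep ∘ there) j

  -- The removed leaves are distinct vertices. This crude form of the bound n - 1 is enough for the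
  -- input length and the loop counts.
  forest-size : ∀ {es} → IsForest es → length es ≤ n
  forest-size {es} forest with ys , u , len , _ ← forest-leaves (length es) es refl forest =
    subst₂ _≤_ len (length-tabulate {n = n} id) (unique-⊆-length u (λ _ → ∈-allFin _))

  module LeafExtension {k : ℕ} {es es′ : List E} {e g : E} {p q y : Fin n}
    (split : es ↭ e ∷ es′) (unique : Unique es) (e-ends : Joined [ e ] p y) (g-ends : Joined [ g ] p q)
    (g∈ : g ∈ es) (isolated : ∀ {z} → ¬ Joined es′ y z)
    (y-leaf : ∀ {z} → Joined es y z → z ≡ p)
    (p-leaves : ∀ {x} → Joined es p x → x ≢ q → ∀ {z} → Joined es x z → z ≡ p)
    (bound : ∀ {u v} → (u , v) ∈ es → degree u es + degree v es ≤ suc k)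
    where

    keep : ∀ {h} → h ∈ e ∷ es′ → h ∈ es
    keep = ∈-resp-↭ (↭-sym split)
    unique-e∷ : Unique (e ∷ es′)
    unique-e∷ = unique-↭ split unique
    unique′ : Unique es′
    unique′ = AllPairs.tail unique-e∷

    degree-mono : ∀ w → degree w es′ ≤ degree w es
    degree-mono w = unique-⊆-length (Unique.filter⁺ (incident? w) unique′) λ h∈ →
      let h∈′ , i = ∈-filter⁻ (incident? w) h∈ in ∈-filter⁺ (incident? w) (keep (there h∈′)) i

    bound′ : ∀ {u v} → (u , v) ∈ es′ → degree u es′ + degree v es′ ≤ suc k
    bound′ h∈ = ≤-trans (+-mono-≤ (degree-mono _) (degree-mono _)) (bound (keep (there h∈)))

    module _ (P′ : Palette (Joined es′) (upTo k)) where

      Meets : E → Set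
      Meets h = Incident p h ⊎ Incident q h
      meets? : ∀ h → Dec (Meets h)
      meets? h = incident? p h ⊎-dec incident? q h
      pairColor : E → ℕ
      pairColor (u , v) = color P′ u v
      forbidden : List ℕ
      forbidden = map pairColor (filter meets? es′)

      _≢g? : ∀ h → Dec (h ≢ g)
      h ≢g? = ¬? (≡-dec _≟_ _≟_ h g)

      -- The edges at p or q other than e number at most d(p) + d(q) − 2 < k.
      forbidden-small : length forbidden < k
      forbidden-small = s≤s⁻¹ (begin
        suc (suc (length forbidden))
          ≡⟨ cong (λ i → suc (suc i)) (length-map pairColor (filter meets? es′)) ⟩
        suc (suc (length (filter meets? es′)))
          ≤⟨ s≤s (unique-⊆-length unique-M M⊆) ⟩
        suc (length (incidents p es ++ filter _≢g? (incidents q es)))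
          ≡⟨ cong suc (length-++ (incidents p es)) ⟩
        suc (degree p es + length (filter _≢g? (incidents q es)))
          ≡⟨ +-suc (degree p es) _ ⟨
        degree p es + suc (length (filter _≢g? (incidents q es)))
          -- The two units gained: `e` meets `p` but is no longer present, and `g`, which meets both
          -- `p` and `q`, is counted in both degrees.
          ≤⟨ +-monoʳ-≤ (degree p es) (unique-⊆-length unique-g∷ g∷⊆) ⟩
        degree p es + degree q es
          ≤⟨ bound-pq g-ends ⟩
        suc k ∎)
        where
        open ≤-Reasoning
        bound-pq : Joined [ g ] p q → degree p es + degree q es ≤ suc k
        bound-pq (inj₁ (here refl)) = bound g∈
        bound-pq (inj₂ (here refl)) = subst (_≤ suc k) (+-comm (degree q es) (degree p es)) (bound g∈)
        unique-M : Unique (e ∷ filter meets? es′)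
        unique-M = unique-∷ (λ e∈ → Unique.Unique[x∷xs]⇒x∉xs unique-e∷ (proj₁ (∈-filter⁻ meets? e∈)))
                            (Unique.filter⁺ meets? unique′)
        M⊆ : ∀ {h} → h ∈ e ∷ filter meets? es′ → h ∈ incidents p es ++ filter _≢g? (incidents q es)
        M⊆ (here refl) = ∈-++⁺ˡ (∈-filter⁺ (incident? p) (keep (here refl)) (proj₁ (incident-ends e-ends)))
        M⊆ {h} (there h∈) with ∈-filter⁻ meets? h∈ | incident? p h
        ... | h∈′ , _        | yes i = ∈-++⁺ˡ (∈-filter⁺ (incident? p) (keep (there h∈′)) i)
        ... | h∈′ , inj₁ i   | no ¬i = contradiction i ¬i
        ... | h∈′ , inj₂ i   | no ¬i = ∈-++⁺ʳ (incidents p es) (∈-filter⁺ _≢g?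
          (∈-filter⁺ (incident? q) (keep (there h∈′)) i)
          λ { refl → ¬i (proj₁ (incident-ends g-ends)) })
        unique-g∷ : Unique (g ∷ filter _≢g? (incidents q es))
        unique-g∷ = unique-∷ (λ g∈′ → proj₂ (∈-filter⁻ _≢g? {xs = incidents q es} g∈′) refl)
                             (Unique.filter⁺ _≢g? (Unique.filter⁺ (incident? q) unique))
        g∷⊆ : ∀ {h} → h ∈ g ∷ filter _≢g? (incidents q es) → h ∈ incidents q es
        g∷⊆ (here refl) = ∈-filter⁺ (incident? q) g∈ (proj₂ (incident-ends g-ends))
        g∷⊆ (there h∈)  = proj₁ (∈-filter⁻ _≢g? {xs = incidents q es} h∈)

      c : ℕ
      c = proj₁ (fresh forbidden forbidden-small)
      c<k : c < k
      c<k = proj₁ (proj₂ (fresh forbidden forbidden-small))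
      c∉ : c ∉ forbidden
      c∉ = proj₂ (proj₂ (fresh forbidden forbidden-small))

      flip-same : ∀ {u v} → SameEdge u v p y → SameEdge v u p y
      flip-same (inj₁ (a , b)) = inj₂ (b , a)
      flip-same (inj₂ (a , b)) = inj₁ (b , a)

      same-ends : ∀ {u v} → Joined [ e ] p y → (u , v) ≡ e → SameEdge u v p y
      same-ends (inj₁ (here refl)) refl = inj₁ (refl , refl)
      same-ends (inj₂ (here refl)) refl = inj₂ (refl , refl)

      same-or-old : ∀ {u v} → Joined es u v → SameEdge u v p y ⊎ Joined es′ u v
      same-or-old (inj₁ r) with ∈-resp-↭ split r
      ... | there r′ = inj₂ (inj₁ r′)
      ... | here r′  = inj₁ (same-ends e-ends r′)
      same-or-old (inj₂ r) with ∈-resp-↭ split r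
      ... | there r′ = inj₂ (inj₂ r′)
      ... | here r′  = inj₁ (flip-same (same-ends e-ends r′))

      old : ∀ {u v} → Joined es u v → ¬ SameEdge u v p y → Joined es′ u v
      old r ¬s with same-or-old r
      ... | inj₁ s = contradiction s ¬s
      ... | inj₂ r = r

      avoids : ∀ {x z} → Joined es′ x z → Meets (x , z) → color P′ x z ≢ c
      avoids (inj₁ r) i eq = c∉ (subst (_∈ forbidden) eq (∈-map⁺ pairColor (∈-filter⁺ meets? r i)))
      avoids {x} {z} (inj₂ r) i eq =
        c∉ (subst (_∈ forbidden) (trans (color-sym P′ {z} {x} (inj₁ r)) eq)
             (∈-map⁺ pairColor (∈-filter⁺ meets? r (swapped i))))
        where
        swapped : Meets (x , z) → Meets (z , x)
        swapped (inj₁ (inj₁ i)) = inj₁ (inj₂ i)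
        swapped (inj₁ (inj₂ i)) = inj₁ (inj₁ i)
        swapped (inj₂ (inj₁ i)) = inj₂ (inj₂ i)
        swapped (inj₂ (inj₂ i)) = inj₂ (inj₁ i)

      -- Why only edges at `p` or `q` matter for the new color: `y` is isolated by now and was
      -- adjacent to `p` alone, and a neighbor of `p` other than `q` has no edge except the one back
      -- to `p`.
      meets : ∀ {u v x z} → SameEdge u v p y → Joined es′ x z → u ≡ x ⊎ Joined es u x → Meets (x , z)
      meets (inj₁ (refl , refl)) r (inj₁ refl) = inj₁ (inj₁ refl)
      meets (inj₂ (refl , refl)) r (inj₁ refl) = contradiction r isolated
      meets (inj₂ (refl , refl)) r (inj₂ s)    = inj₁ (inj₁ (sym (y-leaf s)))
      meets {x = x} (inj₁ (refl , refl)) r (inj₂ s) with x ≟ q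
      ... | yes refl = inj₂ (inj₁ refl)
      ... | no x≢q   = inj₁ (inj₂ (sym (p-leaves s x≢q (joined-map (keep ∘ there) r))))

      flip-near : ∀ {u x} → u ≡ x ⊎ Joined es u x → x ≡ u ⊎ Joined es x u
      flip-near (inj₁ eq) = inj₁ (sym eq)
      flip-near (inj₂ r)  = inj₂ (joined-sym r)

      -- The link between the two old edges cannot be `e`, for then one of them would contain the
      -- isolated vertex `y`.
      old-near : ∀ {u v x z} → Joined es′ u v → Joined es′ x z → u ≡ x ⊎ Joined es u x →
                 u ≡ x ⊎ Joined es′ u x
      old-near r r′ (inj₁ eq) = inj₁ eq
      old-near r r′ (inj₂ s) with same-or-old s
      ... | inj₂ s′                   = inj₂ s′
      ... | inj₁ (inj₁ (refl , refl)) = contradiction r′ isolated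
      ... | inj₁ (inj₂ (refl , refl)) = contradiction r isolated

      col : Fin n → Fin n → ℕ
      col u v with sameEdge? u v p y
      ... | yes _ = c
      ... | no  _ = color P′ u v

      col-sym : ∀ {u v} → Joined es u v → col u v ≡ col v u
      col-sym {u} {v} r with sameEdge? u v p y | sameEdge? v u p y
      ... | yes _ | yes _ = refl
      ... | yes s | no ¬s = contradiction (flip-same s) ¬s
      ... | no ¬s | yes s = contradiction (flip-same s) ¬s
      ... | no ¬s | no _  = color-sym P′ (old r ¬s)

      col-in : ∀ {u v} → Joined es u v → col u v ∈ upTo k
      col-in {u} {v} r with sameEdge? u v p y
      ... | yes _ = ∈-upTo⁺ c<k
      ... | no ¬s = in-palette P′ (old r ¬s)

      same-trans : ∀ {u v x z} → SameEdge u v p y → SameEdge x z p y → SameEdge u v x z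
      same-trans (inj₁ (refl , refl)) (inj₁ (refl , refl)) = inj₁ (refl , refl)
      same-trans (inj₁ (refl , refl)) (inj₂ (refl , refl)) = inj₂ (refl , refl)
      same-trans (inj₂ (refl , refl)) (inj₁ (refl , refl)) = inj₂ (refl , refl)
      same-trans (inj₂ (refl , refl)) (inj₂ (refl , refl)) = inj₁ (refl , refl)

      col-strong : ∀ {u v x z} → Joined es u v → Joined es x z → u ≡ x ⊎ Joined es u x →
                   col u v ≡ col x z → SameEdge u v x z
      col-strong {u} {v} {x} {z} r r′ near eq with sameEdge? u v p y | sameEdge? x z p y
      ... | yes s | yes s′ = same-trans s s′
      ... | yes s | no ¬s  = contradiction (sym eq) (avoids (old r′ ¬s) (meets s (old r′ ¬s) near))
      ... | no ¬s | yes s  = contradiction eq (avoids (old r ¬s) (meets s (old r ¬s) (flip-near near)))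
      ... | no ¬s | no ¬s′ = strong P′ (old r ¬s) (old r′ ¬s′) (old-near (old r ¬s) (old r′ ¬s′) near) eq

      extended : Palette (Joined es) (upTo k)
      extended = record { color = col ; color-sym = col-sym ; in-palette = col-in ; strong = col-strong }

  -- Writing the bound with `suc k` avoids a truncated subtraction. Degrees only drop when edges are
  -- removed, so the same `k` serves throughout the induction.
  forest-palette : ∀ m {k} es → length es ≡ m → IsForest es →
                   (∀ {u v} → (u , v) ∈ es → degree u es + degree v es ≤ suc k) →
                   Palette (Joined es) (upTo k)
  forest-palette zero    []             refl _      _     = edgeless
  forest-palette (suc m) {k} es@(_ ∷ _) len  forest bound
    with record { es′ = es′ ; split = split ; forest′ = forest′ ; e-ends = e-ends ; g-ends = g-ends
                ; g∈ = g∈ ; isolated = isolated ; y-leaf = y-leaf ; p-leaves = p-leaves }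
           ← leafEdge forest (inj₁ (here refl)) =
    Ex.extended (forest-palette m es′ (suc-injective (trans (sym (↭-length split)) len)) forest′ Ex.bound′)
    where
    module Ex = LeafExtension split (IsForest.unique forest) e-ends g-ends g∈ isolated y-leaf p-leaves bound

-- Edge lists of graphs and the coloring with all colors distinct

∈-edges⁺ : ∀ {G u v} → IsEdge G (u , v) → (u , v) ∈ edges G
∈-edges⁺ {G} {u} {v} e =
  ∈-filter⁺ (isEdge? G) (∈-cartesianProduct⁺ (∈-allFin u) (∈-allFin v)) e

∈-edges⁻ : ∀ {G e} → e ∈ edges G → IsEdge G e
∈-edges⁻ {G} e∈ = proj₂ (∈-filter⁻ (isEdge? G) {xs = cartesianProduct (allFin _) (allFin _)} e∈)

edges-unique : ∀ G → Unique (edges G)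
edges-unique G = Unique.filter⁺ (isEdge? G)
  (Unique.cartesianProduct⁺ (Unique.allFin⁺ (order G)) (Unique.allFin⁺ (order G)))

edges-length : ∀ G → length (edges G) ≤ order G * order G
edges-length G = ≤-trans
  (unique-⊆-length (edges-unique G) (λ _ → ∈-cartesianProduct⁺ (∈-allFin _) (∈-allFin _)))
  (≤-reflexive (length-grid (order G) (order G)))

-- Each edge is its own color, named by its ordered pair. This is optimal for complements of trees
-- and a crude upper bound for every other graph.
rainbow : ∀ G → Palette (Adj G) (edges G)
rainbow G = record { color = col ; color-sym = col-sym ; in-palette = col-in ; strong = λ _ _ _ → col-strong }
  where
  col : Vertex G → Vertex G → Vertex G × Vertex G
  col u v with u Fin.<? v
  ... | yes _ = u , v
  ... | no  _ = v , u
  col-sym : ∀ {u v} → Adj G u v → col u v ≡ col v u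
  col-sym {u} {v} a with u Fin.<? v | v Fin.<? u
  ... | yes p | yes q = contradiction q (<-asym p)
  ... | yes _ | no  _ = refl
  ... | no  _ | yes _ = refl
  ... | no ¬p | no ¬q = contradiction (toℕ-injective (≤-antisym (≮⇒≥ ¬q) (≮⇒≥ ¬p))) (adj⇒≢ {G} a)
  col-in : ∀ {u v} → Adj G u v → col u v ∈ edges G
  col-in {u} {v} a with u Fin.<? v
  ... | yes p = ∈-edges⁺ {G} (p , a)
  ... | no ¬p = ∈-edges⁺ {G}
    (≤∧≢⇒< (≮⇒≥ ¬p) (λ eq → adj⇒≢ {G} a (toℕ-injective (sym eq))) , adj-symm {G} a)
  col-strong : ∀ {u v x y} → col u v ≡ col x y → SameEdge u v x y
  col-strong {u} {v} {x} {y} eq with u Fin.<? v | x Fin.<? y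
  col-strong refl | yes _ | yes _ = inj₁ (refl , refl)
  col-strong refl | yes _ | no  _ = inj₂ (refl , refl)
  col-strong refl | no  _ | yes _ = inj₂ (refl , refl)
  col-strong refl | no  _ | no  _ = inj₁ (refl , refl)

-- Needed against overflow: every index that the machine stores is at most quadratic.
optimal-≤ : ∀ {G k} → Optimal G k → k ≤ order G * order G
optimal-≤ {G} o = ≤-trans (minimal o (normalize {G} (rainbow G))) (edges-length G)

-- Complements of trees

-- The binomial coefficient n over 2, summed up as the machine does it, which has no division.
tri : ℕ → ℕ
tri zero    = 0
tri (suc n) = n + tri n

private
  pairs : ∀ n → List (Fin n × Fin n)
  pairs zero    = []
  pairs (suc n) = map (λ v → zero , suc v) (allFin n) ++ map (λ (u , v) → suc u , suc v) (pairs n)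

  pairs-length : ∀ n → length (pairs n) ≡ tri n
  pairs-length zero    = refl
  pairs-length (suc n) = trans (length-++ (map (λ v → zero , suc v) (allFin n)))
    (cong₂ _+_ (trans (length-map _ (allFin n)) (length-tabulate {n = n} id))
               (trans (length-map _ (pairs n)) (pairs-length n)))

  pairs-ordered : ∀ {n u v} → (u , v) ∈ pairs n → u <ᶠ v
  pairs-ordered {suc n} p with ∈-++⁻ (map (λ v → zero , suc v) (allFin n)) p
  ... | inj₁ q with _ , _ , refl ← ∈-map⁻ _ q = s≤s z≤n
  ... | inj₂ q with _ , r , refl ← ∈-map⁻ _ q = s≤s (pairs-ordered r)

  pairs-complete : ∀ {n} {u v : Fin n} → u <ᶠ v → (u , v) ∈ pairs n
  pairs-complete {suc n} {zero}  {suc v} _ = ∈-++⁺ˡ (∈-map⁺ _ (∈-allFin v))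
  pairs-complete {suc n} {suc u} {suc v} (s≤s p) =
    ∈-++⁺ʳ (map _ (allFin n)) (∈-map⁺ _ (pairs-complete p))

  pairs-unique : ∀ n → Unique (pairs n)
  pairs-unique zero    = []
  pairs-unique (suc n) = Unique.++⁺
    (Unique.map⁺ (λ { refl → refl }) (Unique.allFin⁺ n))
    (Unique.map⁺ (λ { refl → refl }) (pairs-unique n))
    λ { (p , q) → disjoint (∈-map⁻ _ p) (∈-map⁻ _ q) }
    where
    disjoint : ∀ {e : Fin (suc n) × Fin (suc n)} → ∃[ v ] (v ∈ allFin n × e ≡ (zero , suc v)) →
               ∃[ f ] (f ∈ pairs n × e ≡ (suc (proj₁ f) , suc (proj₂ f))) → ⊥
    disjoint (_ , _ , refl) (_ , _ , ())

co-adj⁺ : ∀ {G u v} → u ≢ v → ¬ Adj G u v → Adj (complement G) u v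
co-adj⁺ {G} {u} {v} u≢v ¬a with adj G u v | u ≟ v
... | true  | _     = contradiction tt ¬a
... | false | yes p = contradiction p u≢v
... | false | no _  = tt

co-adj⁻ : ∀ {G u v} → Adj (complement G) u v → u ≢ v × ¬ Adj G u v
co-adj⁻ {G} {u} {v} a with adj G u v | u ≟ v
... | false | no p = p , λ ()

complement-edges : ∀ G → length (edges (complement G)) ≡ tri (order G) ∸ length (edges G)
complement-edges G = begin
  length (edges (complement G))
    ≡⟨ m+n∸m≡n (length (edges G)) _ ⟨
  length (edges G) + length (edges (complement G)) ∸ length (edges G)
    ≡⟨ cong (_∸ length (edges G)) (sym (length-++ (edges G))) ⟩
  length (edges G ++ edges (complement G)) ∸ length (edges G)
    ≡⟨ cong (_∸ length (edges G)) (≤-antisym (unique-⊆-length unique ⊆pairs)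
                                            (unique-⊆-length (pairs-unique _) pairs⊆)) ⟩
  length (pairs (order G)) ∸ length (edges G)
    ≡⟨ cong (_∸ length (edges G)) (pairs-length (order G)) ⟩
  tri (order G) ∸ length (edges G) ∎
  where
  open ≡-Reasoning
  unique : Unique (edges G ++ edges (complement G))
  unique = Unique.++⁺ (edges-unique G) (edges-unique (complement G))
    λ (p , q) → proj₂ (co-adj⁻ {G} (proj₂ (∈-edges⁻ {complement G} q))) (proj₂ (∈-edges⁻ {G} p))
  ⊆pairs : ∀ {e} → e ∈ edges G ++ edges (complement G) → e ∈ pairs (order G)
  ⊆pairs p with ∈-++⁻ (edges G) p
  ... | inj₁ q = pairs-complete (proj₁ (∈-edges⁻ {G} q))
  ... | inj₂ q = pairs-complete (proj₁ (∈-edges⁻ {complement G} q))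
  pairs⊆ : ∀ {e} → e ∈ pairs (order G) → e ∈ edges G ++ edges (complement G)
  pairs⊆ {u , v} p with T? (adj G u v)
  ... | yes a = ∈-++⁺ˡ (∈-edges⁺ {G} (pairs-ordered p , a))
  ... | no ¬a = ∈-++⁺ʳ (edges G) (∈-edges⁺ {complement G}
    (pairs-ordered p , co-adj⁺ {G} (λ { refl → <-irrefl refl (pairs-ordered p) }) ¬a))

-- Two non-conflicting edges ab and cd of the complement of G would give the
-- cycle a c b d in G.
cotree-optimal : ∀ {G} {es : List (Vertex G × Vertex G)} → Acyclic G → es ↭ edges G →
                 Optimal (complement G) (tri (order G) ∸ length es)
cotree-optimal {G} {es} acyclic es↭ = optimal {complement G} (rainbow (complement G)) size least
  where
  C = complement G
  size : length (edges C) ≡ tri (order G) ∸ length es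
  size = trans (complement-edges G) (cong (tri (order G) ∸_) (sym (↭-length es↭)))

  near? : (u x : Vertex G) → Dec (u ≡ x ⊎ Adj C u x)
  near? u x = (u ≟ x) ⊎-dec T? (adj C u x)

  far⇒adj : ∀ {u x} → ¬ (u ≡ x ⊎ Adj C u x) → u ≢ x × Adj G u x
  far⇒adj {u} {x} far with T? (adj G u x)
  ... | yes a = (far ∘ inj₁) , a
  ... | no ¬a = contradiction (inj₂ (co-adj⁺ {G} (far ∘ inj₁) ¬a)) far

  least : ∀ {j} → Palette (Adj C) (upTo j) → tri (order G) ∸ length es ≤ j
  least {j} P = begin
    tri (order G) ∸ length es     ≡⟨ size ⟨
    length (edges C)              ≡⟨ length-map pairColor (edges C) ⟨
    length (map pairColor (edges C))
      ≤⟨ unique-⊆-length (unique-map pairColor injective (edges-unique C)) inside ⟩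
    length (upTo j)               ≡⟨ length-upTo j ⟩
    j                             ∎
    where
    open ≤-Reasoning
    pairColor : Vertex C × Vertex C → ℕ
    pairColor (u , v) = color P u v
    inside : ∀ {c} → c ∈ map pairColor (edges C) → c ∈ upTo j
    inside c∈ with _ , e∈ , refl ← ∈-map⁻ pairColor c∈ = in-palette P (proj₂ (∈-edges⁻ {C} e∈))
    injective : ∀ {e f} → e ∈ edges C → f ∈ edges C → pairColor e ≡ pairColor f → e ≡ f
    injective {a , b} {c , d} e∈ f∈ eq
      -- The four pairs of endpoints, in the cyclic order a, c, b, d. If one of them is equal or
      -- adjacent in the complement, equal colors force equal edges; otherwise all four are edges of
      -- `G`.
      with near? a c | near? c b | near? b d | near? d a
    ... | yes n | _ | _ | _ = cong proj₁ (edgeColor-injective {C} P (_ , ∈-edges⁻ {C} e∈)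
      (_ , ∈-edges⁻ {C} f∈) (inj₁ refl) (inj₁ refl) n eq)
    ... | _ | yes n | _ | _ = sym (cong proj₁ (edgeColor-injective {C} P (_ , ∈-edges⁻ {C} f∈)
      (_ , ∈-edges⁻ {C} e∈) (inj₁ refl) (inj₂ refl) n (sym eq)))
    ... | _ | _ | yes n | _ = cong proj₁ (edgeColor-injective {C} P (_ , ∈-edges⁻ {C} e∈)
      (_ , ∈-edges⁻ {C} f∈) (inj₂ refl) (inj₂ refl) n eq)
    ... | _ | _ | _ | yes n = sym (cong proj₁ (edgeColor-injective {C} P (_ , ∈-edges⁻ {C} f∈)
      (_ , ∈-edges⁻ {C} e∈) (inj₂ refl) (inj₁ refl) n (sym eq)))
    ... | no ac | no cb | no bd | no da = contradiction
      ( s≤s (s≤s z≤n)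
      , (proj₁ (far⇒adj ac) ∷ adj⇒≢ {C} (proj₂ (∈-edges⁻ {C} e∈)) ∷ ≢-sym (proj₁ (far⇒adj da)) ∷ [])
        ∷ (proj₁ (far⇒adj cb) ∷ adj⇒≢ {C} (proj₂ (∈-edges⁻ {C} f∈)) ∷ [])
        ∷ (proj₁ (far⇒adj bd) ∷ []) ∷ [] ∷ []
      , proj₂ (far⇒adj ac) ∷ proj₂ (far⇒adj cb) ∷ proj₂ (far⇒adj bd) ∷ proj₂ (far⇒adj da) ∷ [-])
      (acyclic a (c ∷ b ∷ d ∷ []))

-- Trees

flat : ∀ {n} → List (Fin n × Fin n) → List ℕ
flat = concatMap (λ (u , v) → toℕ u ∷ toℕ v ∷ [])

δ : ℕ → ℕ → ℕ
δ x y = if x ≡ᵇ y then 1 else 0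

count : ℕ → List ℕ → ℕ
count x []       = 0
count x (y ∷ ys) = δ x y + count x ys

count-≤ : ∀ x ys → count x ys ≤ length ys
count-≤ x []       = z≤n
count-≤ x (y ∷ ys) with x ≡ᵇ y
... | true  = s≤s (count-≤ x ys)
... | false = m≤n⇒m≤1+n (count-≤ x ys)

-- b + (x ∸ b) is the maximum of b and x.
sweep : ∀ {n} → (ℕ → ℕ) → ℕ → List (Fin n × Fin n) → ℕ
sweep f b []             = b
sweep f b ((u , v) ∷ es) = sweep f (b + (f (toℕ u) + f (toℕ v) ∸ 1 ∸ b)) es

module _ {n : ℕ} (f : ℕ → ℕ) where

  private
    E = Fin n × Fin n

  sweep-≥ : ∀ b (es : List E) → b ≤ sweep f b es
  sweep-≥ b []       = ≤-refl
  sweep-≥ b (_ ∷ es) = ≤-trans (m≤m+n b _) (sweep-≥ _ es)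

  sweep-edge : ∀ b (es : List E) {u v} → (u , v) ∈ es → f (toℕ u) + f (toℕ v) ∸ 1 ≤ sweep f b es
  sweep-edge b (_ ∷ es) (here refl) = ≤-trans (m≤n+m∸n _ b) (sweep-≥ _ es)
  sweep-edge b (_ ∷ es) (there e∈)  = sweep-edge _ es e∈

  sweep-≤ : ∀ {j} b (es : List E) → b ≤ j →
            (∀ {u v} → (u , v) ∈ es → f (toℕ u) + f (toℕ v) ∸ 1 ≤ j) → sweep f b es ≤ j
  sweep-≤ b [] b≤j bound = b≤j
  sweep-≤ {j} b ((u , v) ∷ es) b≤j bound = sweep-≤ _ es step (bound ∘ there)
    where
    x = f (toℕ u) + f (toℕ v) ∸ 1
    step : b + (x ∸ b) ≤ j
    step with ≤-total b x
    ... | inj₁ b≤x = subst (_≤ j) (sym (m+[n∸m]≡n b≤x)) (bound (here refl))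
    ... | inj₂ x≤b = subst (_≤ j) (sym (trans (cong (b +_) (m≤n⇒m∸n≡0 x≤b)) (+-identityʳ b))) b≤j

toℕ-≡ᵇ : ∀ {n} (u v : Fin n) → (toℕ u ≡ᵇ toℕ v) ≡ does (u ≟ v)
toℕ-≡ᵇ u v with u ≟ v
... | yes refl = dec-true (toℕ u ℕ.≟ toℕ u) refl
... | no u≢v   = dec-false (toℕ u ℕ.≟ toℕ v) (u≢v ∘ toℕ-injective)

-- Without loops, an incident edge contributes exactly one occurrence of its endpoint to the
-- flattened list, which is what the program can count.
count-degree : ∀ {n} (w : Fin n) es → (∀ {u v} → (u , v) ∈ es → u ≢ v) →
               count (toℕ w) (flat es) ≡ degree w es
count-degree w []             _ = refl
count-degree w ((u , v) ∷ es) loopless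
  rewrite toℕ-≡ᵇ w u | toℕ-≡ᵇ w v
  with ih ← count-degree w es (loopless ∘ there) | w ≟ u | w ≟ v
... | yes refl | yes refl = contradiction refl (loopless (here refl))
... | yes _    | no  _    = cong suc ih
... | no  _    | yes _    = cong suc ih
... | no  _    | no  _    = ih

module _ {G : Graph} {es : List (Vertex G × Vertex G)} (es↭ : es ↭ edges G) where

  private
    is-edge : ∀ {e} → e ∈ es → IsEdge G e
    is-edge e∈ = ∈-edges⁻ {G} (∈-resp-↭ es↭ e∈)

    es-unique : Unique es
    es-unique = unique-↭ (↭-sym es↭) (edges-unique G)

    joined⇒adj : ∀ {u v} → Joined es u v → Adj G u v
    joined⇒adj (inj₁ e∈) = proj₂ (is-edge e∈)
    joined⇒adj (inj₂ e∈) = adj-symm {G} (proj₂ (is-edge e∈))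

    adj⇒joined : ∀ {u v} → Adj G u v → Joined es u v
    adj⇒joined {u} {v} a with Fin.<-cmp u v
    ... | tri< p _ _    = inj₁ (∈-resp-↭ (↭-sym es↭) (∈-edges⁺ {G} (p , a)))
    ... | tri≈ _ refl _ = contradiction a (irreflexive {G})
    ... | tri> _ _ p    = inj₂ (∈-resp-↭ (↭-sym es↭) (∈-edges⁺ {G} (p , adj-symm {G} a)))

  acyclic⇒forest : Acyclic G → IsForest es
  acyclic⇒forest acyclic = record
    { ordered = λ e∈ → proj₁ (is-edge e∈)
    ; unique  = es-unique
    ; acyclic = λ v vs (len , u , l) → acyclic v vs (len , u , Linked.map joined⇒adj l)
    }

  -- The edges at u or v pairwise conflict.
  degree-sum-≤ : ∀ {j u v} → Palette (Adj G) (upTo j) → (u , v) ∈ es →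
                 degree u es + degree v es ∸ 1 ≤ j
  degree-sum-≤ {j} {u} {v} P uv∈ = begin
    degree u es + degree v es ∸ 1
      -- Only `uv` meets both `u` and `v`, so `others` lacks just one edge at `v`.
      ≤⟨ ∸-monoˡ-≤ 1 (+-monoʳ-≤ (degree u es) (unique-⊆-length
           (Unique.filter⁺ (incident? v) es-unique) at-v)) ⟩
    degree u es + suc (length others) ∸ 1
      ≡⟨ cong (_∸ 1) (+-suc (degree u es) (length others)) ⟩
    degree u es + length others
      ≡⟨ length-++ (incidents u es) ⟨
    length M
      ≡⟨ length-map pairColor M ⟨
    length (map pairColor M)
      ≤⟨ unique-⊆-length (unique-map pairColor injective unique-M) inside ⟩
    length (upTo j)
      ≡⟨ length-upTo j ⟩
    j ∎
    where
    open ≤-Reasoning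
    off? : ∀ e → Dec (¬ Incident u e)
    off? e = ¬? (incident? u e)
    others M : List (Vertex G × Vertex G)
    others = filter off? (incidents v es)
    M = incidents u es ++ others
    pairColor : Vertex G × Vertex G → ℕ
    pairColor (a , b) = color P a b
    at-v : ∀ {e} → e ∈ incidents v es → e ∈ (u , v) ∷ others
    at-v {e} e∈ with incident? u e | ∈-filter⁻ (incident? v) {xs = es} e∈
    ... | no ¬i | _       = there (∈-filter⁺ off? e∈ ¬i)
    ... | yes i | e∈′ , k = here (cong proj₁ (edge-by-endpoints {G} (e , is-edge e∈′)
      (_ , is-edge uv∈) (adj⇒≢ {G} (proj₂ (is-edge uv∈))) i k (inj₁ refl) (inj₂ refl)))
    M⁻ : ∀ {e} → e ∈ M → e ∈ es × ∃[ w ] ((w ≡ u ⊎ w ≡ v) × Incident w e)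
    M⁻ e∈ with ∈-++⁻ (incidents u es) e∈
    ... | inj₁ p = let e∈′ , i = ∈-filter⁻ (incident? u) {xs = es} p in e∈′ , u , inj₁ refl , i
    ... | inj₂ p = let e∈′ , i = ∈-filter⁻ (incident? v) {xs = es}
                                   (proj₁ (∈-filter⁻ off? {xs = incidents v es} p))
                   in e∈′ , v , inj₂ refl , i
    unique-M : Unique M
    unique-M = Unique.++⁺ (Unique.filter⁺ (incident? u) es-unique)
      (Unique.filter⁺ off? (Unique.filter⁺ (incident? v) es-unique))
      λ (p , q) → proj₂ (∈-filter⁻ off? {xs = incidents v es} q)
                        (proj₂ (∈-filter⁻ (incident? u) {xs = es} p))
    near : ∀ {w x} → (w ≡ u ⊎ w ≡ v) → (x ≡ u ⊎ x ≡ v) → w ≡ x ⊎ Adj G w x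
    near (inj₁ refl) (inj₁ refl) = inj₁ refl
    near (inj₁ refl) (inj₂ refl) = inj₂ (proj₂ (is-edge uv∈))
    near (inj₂ refl) (inj₁ refl) = inj₂ (adj-symm {G} (proj₂ (is-edge uv∈)))
    near (inj₂ refl) (inj₂ refl) = inj₁ refl
    injective : ∀ {e f} → e ∈ M → f ∈ M → pairColor e ≡ pairColor f → e ≡ f
    injective e∈ f∈ eq with M⁻ e∈ | M⁻ f∈
    ... | e∈′ , _ , p , i | f∈′ , _ , q , k = cong proj₁ (edgeColor-injective {G} P
      (_ , is-edge e∈′) (_ , is-edge f∈′) i k (near p q) eq)
    inside : ∀ {c} → c ∈ map pairColor M → c ∈ upTo j
    inside c∈ with _ , e∈ , refl ← ∈-map⁻ pairColor c∈ =
      in-palette P (proj₂ (is-edge (proj₁ (M⁻ e∈))))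

  -- Greedy coloring and the degree-sum bound meet at this value. It is stated by occurrence counts
  -- because the program finds these in its heap; the start value `0` is the index of the tree
  -- without edges.
  tree-optimal : Acyclic G → Optimal G (sweep (λ x → count x (flat es)) 0 es)
  tree-optimal acyclic = record
    { attained = pullback {R = Adj G} id id adj⇒joined
                   (forest-palette (length es) es refl (acyclic⇒forest acyclic) bound)
    ; minimal  = λ {j} P → sweep-≤ f 0 es z≤n λ e∈ →
                   subst (_≤ j) (sym (f-degrees _ _)) (degree-sum-≤ P e∈)
    }
    where
    f : ℕ → ℕ
    f x = count x (flat es)
    f-degree : ∀ w → f (toℕ w) ≡ degree w es
    f-degree w = count-degree w es (λ e∈ → adj⇒≢ {G} (proj₂ (is-edge e∈)))
    f-degrees : ∀ u v → f (toℕ u) + f (toℕ v) ∸ 1 ≡ degree u es + degree v es ∸ 1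
    f-degrees u v = cong₂ (λ a b → a + b ∸ 1) (f-degree u) (f-degree v)
    bound : ∀ {u v} → (u , v) ∈ es → degree u es + degree v es ≤ suc (sweep f 0 es)
    bound {u} {v} e∈ = ≤-trans (m≤n+m∸n _ 1) (s≤s
      (subst (_≤ sweep f 0 es) (f-degrees u v) (sweep-edge f 0 es e∈)))

-- Symbolic execution

-- Registers form an explicit list, so that reading and writing a numbered register reduces by
-- computation, while memory stays an abstract function.
Config : Set
Config = List ℕ × (ℕ → ℕ)

set : List ℕ → ℕ → ℕ → List ℕ
set []      zero    x = x ∷ []
set []      (suc i) x = 0 ∷ set [] i x
set (_ ∷ v) zero    x = x ∷ v
set (y ∷ v) (suc i) x = y ∷ set v i x

cells-set : ∀ v k x r → cells (set v k x) r ≡ (cells v [ k ↦ x ]) r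
cells-set []      zero    x zero    = refl
cells-set []      zero    x (suc r) = refl
cells-set []      (suc k) x zero    = refl
cells-set []      (suc k) x (suc r) = cells-set [] k x r
cells-set (y ∷ v) zero    x zero    = refl
cells-set (y ∷ v) zero    x (suc r) = refl
cells-set (y ∷ v) (suc k) x zero    = refl
cells-set (y ∷ v) (suc k) x (suc r) = cells-set v k x r

valueᶜ : Expr → Config → ℕ
valueᶜ (const k)  (v , μ) = k
valueᶜ (reg r)    (v , μ) = cells v r
valueᶜ (op o r q) (v , μ) = ⟦ o ⟧ (cells v r) (cells v q)
valueᶜ (load r)   (v , μ) = μ (cells v r)

_∼_ : State → Config → Set
s ∼ (v , μ) = (∀ r → regs s r ≡ cells v r) × mem s ≡ μ

-- States are compared with configurations register by register: register
-- files are functions, for which no extensionality is available.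
record Exec (W : ℕ) (P : Program) (c : Config) (t : ℕ) (c′ : Config) : Set where
  constructor exec
  field
    run : ∀ s → s ∼ c → ∃[ s′ ] Run W P s t s′ × s′ ∼ c′

open Exec

-- Meaningless on control flow, which Safe excludes.
after : Program → Config → Config
after (r ≔ e)       c       = set (proj₁ c) r (valueᶜ e c) , proj₂ c
after (store a x)   (v , μ) = v , μ [ cells v a ↦ cells v x ]
after (P ⨾ Q)       c       = after Q (after P c)
after skip          c       = c
after (ifnz _ _ _)  c       = c
after (while _ _)   c       = c

cost : Program → ℕ
cost (P ⨾ Q) = cost P + cost Q
cost _       = 1

-- On concrete straight-line code this unfolds to a tuple with one overflow bound per assignment.
Safe : ℕ → Program → Config → Set
Safe W skip         c = ⊤
Safe W (r ≔ e)      c = valueᶜ e c < W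
Safe W (store _ _)  c = ⊤
Safe W (P ⨾ Q)      c = Safe W P c × Safe W Q (after P c)
Safe W (ifnz _ _ _) c = ⊥
Safe W (while _ _)  c = ⊥

module _ {W : ℕ} where

  value-∼ : ∀ e {s c} → s ∼ c → value e s ≡ valueᶜ e c
  value-∼ (const k)  _           = refl
  value-∼ (reg r)    (ρ , _)     = ρ r
  value-∼ (op o r q) (ρ , _)     = cong₂ ⟦ o ⟧ (ρ r) (ρ q)
  value-∼ (load r) {s} (ρ , refl) = cong (mem s) (ρ r)

  -- Transport in a single register, marked by the argument of `v`; the other registers agree by
  -- computation.
  retarget : ∀ {P c t i j μ} (v : ℕ → List ℕ) → i ≡ j → Exec W P c t (v i , μ) → Exec W P c t (v j , μ)
  retarget v refl e = e

  resource : ∀ {P c t i j μ} (v : ℕ → List ℕ) → i ≡ j → Exec W P (v i , μ) t c → Exec W P (v j , μ) t c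
  resource v refl e = e

  infixr 4 _then_

  _then_ : ∀ {P Q c c′ c″ t t′} → Exec W P c t c′ → Exec W Q c′ t′ c″ → Exec W (P ⨾ Q) c (t + t′) c″
  (e then f) .run s s∼ =
    let s₁ , r₁ , ∼₁ = run e s s∼
        s₂ , r₂ , ∼₂ = run f s₁ ∼₁
    in s₂ , seq r₁ r₂ , ∼₂

  -- Makes the type checker the symbolic executor: `after` and `cost` reduce on concrete code, and
  -- only the bounds in `Safe` remain to be proved.
  straight : ∀ P {c} → Safe W P c → Exec W P c (cost P) (after P c)
  straight skip    _    .run s s∼ = s , skip , s∼
  straight (r ≔ e) {c} safe .run s s∼@(ρ , refl) =
    _ , assign (subst (_< W) (sym (value-∼ e s∼)) safe) , ρ′ , refl
    where
    ρ′ : ∀ q → (regs s [ r ↦ value e s ]) q ≡ cells (set (proj₁ c) r (valueᶜ e c)) q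
    ρ′ q rewrite cells-set (proj₁ c) r (valueᶜ e c) q | value-∼ e s∼ | ρ q = refl
  straight (store a x) _ .run s s∼@(ρ , refl) =
    _ , store , ρ , cong₂ (mem s [_↦_]) (ρ a) (ρ x)
  straight (P ⨾ Q) (p , q) = straight P p then straight Q q

  ifnz-≢0 : ∀ {r P Q c t c′} → cells (proj₁ c) r ≢ 0 → Exec W P c t c′ → Exec W (ifnz r P Q) c (suc t) c′
  ifnz-≢0 ≢0 e .run s s∼ =
    let s₁ , r₁ , ∼₁ = run e s s∼ in s₁ , if-≢0 (≢0 ∘ trans (sym (proj₁ s∼ _))) r₁ , ∼₁

  ifnz-≡0 : ∀ {r P Q c t c′} → cells (proj₁ c) r ≡ 0 → Exec W Q c t c′ → Exec W (ifnz r P Q) c (suc t) c′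
  ifnz-≡0 ≡0 e .run s s∼ =
    let s₁ , r₁ , ∼₁ = run e s s∼ in s₁ , if-≡0 (trans (proj₁ s∼ _) ≡0) r₁ , ∼₁

  while-≢0 : ∀ {r P c c′ c″ t t′} → cells (proj₁ c) r ≢ 0 → Exec W P c t c′ →
             Exec W (while r P) c′ t′ c″ → Exec W (while r P) c (suc (t + t′)) c″
  while-≢0 ≢0 e f .run s s∼ =
    let s₁ , r₁ , ∼₁ = run e s s∼
        s₂ , r₂ , ∼₂ = run f s₁ ∼₁
    in s₂ , loop (≢0 ∘ trans (sym (proj₁ s∼ _))) r₁ r₂ , ∼₂

  while-≡0 : ∀ {r P c} → cells (proj₁ c) r ≡ 0 → Exec W (while r P) c 1 c
  while-≡0 ≡0 .run s s∼ = s , exit (trans (proj₁ s∼ _) ≡0) , s∼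

-- Words stored in memory

Holds : (ℕ → ℕ) → ℕ → List ℕ → Set
Holds μ a []       = ⊤
Holds μ a (x ∷ xs) = μ a ≡ x × Holds μ (suc a) xs

holds-++ : ∀ {μ} a xs {ys} → Holds μ a (xs ++ ys) → Holds μ a xs × Holds μ (a + length xs) ys
holds-++ {μ} a []       {ys} hs      = tt , subst (λ a → Holds μ a ys) (sym (+-identityʳ a)) hs
holds-++ {μ} a (x ∷ xs) {ys} (h , hs) =
  let hs₁ , hs₂ = holds-++ (suc a) xs hs
  in (h , hs₁) , subst (λ a → Holds μ a ys) (sym (+-suc a (length xs))) hs₂

holds-cong : ∀ {μ μ′} a xs → (∀ b → a ≤ b → b < a + length xs → μ′ b ≡ μ b) →
             Holds μ a xs → Holds μ′ a xs
holds-cong a []       same _        = tt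
holds-cong a (x ∷ xs) same (h , hs) =
  trans (same a ≤-refl (m<m+n a z<s)) h ,
  holds-cong (suc a) xs
    (λ b a<b b< → same b (<⇒≤ a<b) (subst (b <_) (sym (+-suc a (length xs))) b<)) hs

holds-cells : ∀ w → Holds (cells w) 0 w
holds-cells w = go w 0 λ _ → refl
  where
  go : ∀ xs a → (∀ i → cells w (a + i) ≡ cells xs i) → Holds (cells w) a xs
  go []       a eq = tt
  go (x ∷ xs) a eq = trans (cong (cells w) (sym (+-identityʳ a))) (eq 0) ,
    go xs (suc a) λ i → trans (cong (cells w) (sym (+-suc a i))) (eq (suc i))

cells-beyond : ∀ w a → length w ≤ a → cells w a ≡ 0
cells-beyond []      _       _         = refl
cells-beyond (_ ∷ w) (suc a) (s≤s len) = cells-beyond w a len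

update-same : ∀ (f : ℕ → ℕ) a {x} → (f [ a ↦ x ]) a ≡ x
update-same f a rewrite dec-true (a ℕ.≟ a) refl = refl

update-other : ∀ (f : ℕ → ℕ) {a b x} → a ≢ b → (f [ a ↦ x ]) b ≡ f b
update-other f {a} {b} a≢b rewrite dec-false (a ℕ.≟ b) a≢b = refl

-- The program

-- Registers: 0 counts the unread input words, 1 points to the next one, 2 to
-- the first free stack cell, 3 to untouched memory; 4 holds the constant 1 and
-- 10 the input length.  The stack overwrites the part of the input already
-- read and stores for each evaluated subtree its order and index, which are
-- computed in registers 7 and 6.
tally maximize accumulate header treeLeaf cotreeLeaf pop inner push body start finish program : Program

tally = 12 ≔ load 1 ⨾ 12 ≔ op add 3 12 ⨾ 13 ≔ load 12 ⨾ 13 ≔ op add 13 4 ⨾ store 12 13 ⨾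
        1 ≔ op add 4 1 ⨾ 9 ≔ op sub 9 4

maximize = 12 ≔ load 1 ⨾ 12 ≔ op add 3 12 ⨾ 12 ≔ load 12 ⨾ 1 ≔ op add 4 1 ⨾
           13 ≔ load 1 ⨾ 13 ≔ op add 3 13 ⨾ 13 ≔ load 13 ⨾ 1 ≔ op add 4 1 ⨾
           12 ≔ op add 12 13 ⨾ 12 ≔ op sub 12 4 ⨾ 12 ≔ op sub 12 6 ⨾ 6 ≔ op add 6 12 ⨾
           9 ≔ op sub 9 4

accumulate = 9 ≔ op sub 9 4 ⨾ 6 ≔ op add 9 6

header = 7 ≔ load 1 ⨾ 1 ≔ op add 4 1 ⨾ 8 ≔ load 1 ⨾ 1 ≔ op add 4 1

-- Two passes over the edge list, whose start is kept in register 11: the first counts the 2m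
-- endpoints in the heap, the second takes the maximum over the m edges. At the end register 3
-- leaves the n used counters behind.
treeLeaf = header ⨾ (11 ≔ reg 1 ⨾ 9 ≔ op add 8 8) ⨾ while 9 tally ⨾
           (1 ≔ reg 11 ⨾ 6 ≔ const 0 ⨾ 9 ≔ reg 8) ⨾ while 9 maximize ⨾ 3 ≔ op add 3 7

-- The 2m words of the edge list are skipped, as only n and m enter the result.
cotreeLeaf = header ⨾ (1 ≔ op add 1 8 ⨾ 1 ≔ op add 1 8 ⨾ 6 ≔ const 0 ⨾ 9 ≔ reg 7) ⨾
             while 9 accumulate ⨾ 6 ≔ op sub 6 8

pop = 2 ≔ op sub 2 4 ⨾ 6 ≔ load 2 ⨾ 2 ≔ op sub 2 4 ⨾ 7 ≔ load 2 ⨾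
      2 ≔ op sub 2 4 ⨾ 8 ≔ load 2 ⨾ 2 ≔ op sub 2 4 ⨾ 9 ≔ load 2

-- The tag arrives decremented once; after the second decrement it is 0 at a union and 1 at a join.
inner = 5 ≔ op sub 5 4 ⨾ pop ⨾
        ifnz 5 (6 ≔ op add 8 6 ⨾ 8 ≔ op mul 9 7 ⨾ 6 ≔ op add 6 8)
               (8 ≔ op sub 8 6 ⨾ 6 ≔ op add 6 8) ⨾
        7 ≔ op add 9 7

push = store 2 7 ⨾ 2 ≔ op add 4 2 ⨾ store 2 6 ⨾ 2 ≔ op add 4 2 ⨾ 0 ≔ op sub 10 1

body = (5 ≔ load 1 ⨾ 1 ≔ op add 4 1) ⨾
       ifnz 5 (5 ≔ op sub 5 4 ⨾ ifnz 5 inner cotreeLeaf) treeLeaf ⨾ push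

start = 10 ≔ reg 0 ⨾ 3 ≔ reg 0 ⨾ 4 ≔ const 1

-- The one remaining stack entry has its order in cell 0 and its index in cell 1.
finish = 5 ≔ const 1 ⨾ 0 ≔ load 5

program = start ⨾ while 0 body ⨾ finish

file : (r₀ p sp h r₅ r₆ r₇ r₈ r₉ len r₁₁ r₁₂ r₁₃ : ℕ) → List ℕ
file r₀ p sp h r₅ r₆ r₇ r₈ r₉ len r₁₁ r₁₂ r₁₃ =
  r₀ ∷ p ∷ sp ∷ h ∷ 1 ∷ r₅ ∷ r₆ ∷ r₇ ∷ r₈ ∷ r₉ ∷ len ∷ r₁₁ ∷ r₁₂ ∷ r₁₃ ∷ []

-- Invariants of the loops inside a leaf

δ-≤1 : ∀ x y → δ x y ≤ 1
δ-≤1 x y with x ≡ᵇ y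
... | true  = ≤-refl
... | false = z≤n

module Loops {W B : ℕ} (B<W : B < W) {r₀ sp h r₅ r₇ r₈ len r₁₁ : ℕ} where

  fits : ∀ {x} → x ≤ B → x < W
  fits x≤B = ≤-<-trans x≤B B<W

  update-count : ∀ (μ : ℕ → ℕ) h x a → (μ [ h + x ↦ μ (h + x) + 1 ]) (h + a) ≡ μ (h + a) + δ a x
  update-count μ h x a with a ℕ.≟ x
  ... | yes refl rewrite dec-true (a ℕ.≟ a) refl = update-same μ (h + a)
  ... | no a≢x rewrite dec-false (a ℕ.≟ x) a≢x =
    trans (update-other μ (λ eq → a≢x (sym (+-cancelˡ-≡ h x a eq)))) (sym (+-identityʳ _))

  -- Each remaining word raises a counter by at most 1, so the bound on `μ (h + a) + length xs` is
  -- an invariant that excludes overflow. As the words end before `h`, counting does not overwrite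
  -- them. A round costs seven instructions and one test.
  tally-loop : ∀ xs {p r₆ r₁₂ r₁₃ μ n} → Holds μ p xs → p + length xs ≤ h → All (_< n) xs → h + n ≤ B →
    (∀ a → μ (h + a) + length xs ≤ B) →
    ∃[ x ] ∃[ y ] ∃[ μ′ ]
      Exec W (while 9 tally)
           (file r₀ p sp h r₅ r₆ r₇ r₈ (length xs) len r₁₁ r₁₂ r₁₃ , μ)
           (suc (length xs * 8))
           (file r₀ (p + length xs) sp h r₅ r₆ r₇ r₈ 0 len r₁₁ x y , μ′)
      × (∀ a → a < h → μ′ a ≡ μ a)
      × (∀ a → μ′ (h + a) ≡ μ (h + a) + count a xs)
  tally-loop [] {p} {r₆} {r₁₂} {r₁₃} {μ} _ _ _ _ _ =
    r₁₂ , r₁₃ , μ ,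
    retarget (λ q → file r₀ q sp h r₅ r₆ r₇ r₈ 0 len r₁₁ r₁₂ r₁₃)
          (sym (+-identityʳ p)) (while-≡0 refl) ,
    (λ _ _ → refl) , λ a → sym (+-identityʳ _)
  tally-loop (x ∷ xs) {p} {r₆} {r₁₂} {r₁₃} {μ} {n} (refl , hs) p≤h (x<n ∷ xs<n) h+n≤B low =
    let y , z , μ″ , ex , below , counts =
          tally-loop xs {suc p} {r₆} {h + x} {μ (h + x) + 1} {μ₁}
            (holds-cong (suc p) xs (λ b _ b< → update-other μ (heap≢ (<-≤-trans b< 1+p≤h))) hs)
            1+p≤h xs<n h+n≤B low′
    in y , z , μ″ ,
       retarget (λ q → file r₀ q sp h r₅ r₆ r₇ r₈ 0 len r₁₁ y z)
             (sym (+-suc p (length xs)))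
             (while-≢0 1+n≢0 (straight tally
               ( fits (≤-trans (m≤n+m x h) h+x≤B) , fits h+x≤B
               , fits (≤-trans (m≤m+n _ _) (low x)) , fits heap-x , tt
               , fits (≤-trans (m≤m+n (suc p) (length xs)) (≤-trans 1+p≤h h≤B))
               , fits (≤-trans (n≤1+n _) (≤-trans (m≤n+m _ _) (low 0))))) ex) ,
       (λ a a<h → trans (below a a<h) (update-other μ (heap≢ a<h))) ,
       λ a → trans (counts a) (trans (cong (_+ count a xs) (update-count μ h x a)) (+-assoc (μ (h + a)) (δ a x) _))
    where
    μ₁ = μ [ h + x ↦ μ (h + x) + 1 ]
    1+p≤h : suc p + length xs ≤ h
    1+p≤h = subst (_≤ h) (+-suc p (length xs)) p≤h
    h≤B : h ≤ B
    h≤B = ≤-trans (m≤m+n h n) h+n≤B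
    h+x≤B : h + x ≤ B
    h+x≤B = ≤-trans (+-monoʳ-≤ h (<⇒≤ x<n)) h+n≤B
    heap≢ : ∀ {b} → b < h → h + x ≢ b
    heap≢ b<h eq = <⇒≱ b<h (subst (h ≤_) eq (m≤m+n h x))
    heap-x : μ (h + x) + 1 ≤ B
    heap-x = ≤-trans (m≤m+n _ (length xs)) (subst (_≤ B) (sym (+-assoc _ 1 (length xs))) (low x))
    low′ : ∀ a → μ₁ (h + a) + length xs ≤ B
    low′ a = begin
      μ₁ (h + a) + length xs            ≡⟨ cong (_+ length xs) (update-count μ h x a) ⟩
      μ (h + a) + δ a x + length xs     ≤⟨ +-monoˡ-≤ (length xs) (+-monoʳ-≤ (μ (h + a)) (δ-≤1 a x)) ⟩
      μ (h + a) + 1 + length xs         ≡⟨ +-assoc (μ (h + a)) 1 (length xs) ⟩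
      μ (h + a) + suc (length xs)       ≤⟨ low a ⟩
      B                                 ∎
      where open ≤-Reasoning

  tri-loop : ∀ n {p r₆ r₁₂ r₁₃ μ} → n ≤ B → tri n + r₆ ≤ B →
    Exec W (while 9 accumulate) (file r₀ p sp h r₅ r₆ r₇ r₈ n len r₁₁ r₁₂ r₁₃ , μ) (suc (n * 3))
           (file r₀ p sp h r₅ (tri n + r₆) r₇ r₈ 0 len r₁₁ r₁₂ r₁₃ , μ)
  tri-loop zero    _     _     = while-≡0 refl
  tri-loop (suc n) {p} {r₆} {r₁₂} {r₁₃} {μ} n<B bound =
    retarget (λ z → file r₀ p sp h r₅ z r₇ r₈ 0 len r₁₁ r₁₂ r₁₃)
          (sym eq)
          (while-≢0 1+n≢0
            (straight accumulate (fits n≤B , fits (≤-trans (m≤n+m _ (tri n)) (subst (_≤ B) eq bound))))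
            (tri-loop n n≤B (subst (_≤ B) eq bound)))
    where
    n≤B : n ≤ B
    n≤B = ≤-trans (n≤1+n n) n<B
    eq : n + tri n + r₆ ≡ tri n + (n + r₆)
    eq = trans (cong (_+ r₆) (+-comm n (tri n))) (+-assoc (tri n) n r₆)

  -- The values read are variables here, so that matching on `refl` identifies them with the memory
  -- cells before execution; at the call they are of the form `toℕ u`, where such a match would
  -- fail.
  maximize-step : ∀ {p b r₉ r₁₂ r₁₃ μ x y} → μ p ≡ x → μ (suc p) ≡ y → suc (suc p) ≤ B →
    h + x ≤ B → h + y ≤ B → μ (h + x) + μ (h + y) ≤ B →
    b + (μ (h + x) + μ (h + y) ∸ 1 ∸ b) ≤ B → r₉ ≤ B →
    Exec W maximize (file r₀ p sp h r₅ b r₇ r₈ (suc r₉) len r₁₁ r₁₂ r₁₃ , μ) 13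
         (file r₀ (suc (suc p)) sp h r₅ (b + (μ (h + x) + μ (h + y) ∸ 1 ∸ b)) r₇ r₈ r₉ len r₁₁
               (μ (h + x) + μ (h + y) ∸ 1 ∸ b) (μ (h + y)) , μ)
  maximize-step {p} {b} {μ = μ} refl refl p≤B hx≤B hy≤B sum≤B best≤B r₉≤B = straight maximize
    ( fits (≤-trans (m≤n+m _ h) hx≤B) , fits hx≤B , fits (≤-trans (m≤m+n _ _) sum≤B)
    , fits (<⇒≤ p≤B)
    , fits (≤-trans (m≤n+m _ h) hy≤B) , fits hy≤B , fits (≤-trans (m≤n+m _ _) sum≤B)
    , fits p≤B , fits sum≤B , fits (≤-trans (m∸n≤m _ 1) sum≤B)
    , fits (≤-trans (m≤n+m _ b) best≤B) , fits best≤B , fits r₉≤B )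

  -- It is enough that the final maximum fits: by `sweep-≥` the intermediate ones only grow towards
  -- it.
  sweep-loop : ∀ {n} (es : List (Fin n × Fin n)) {p r₆ r₁₂ r₁₃ μ} →
    Holds μ p (flat es) → p + length (flat es) ≤ B → h + n ≤ B →
    (∀ x y → μ (h + x) + μ (h + y) ≤ B) → sweep (λ x → μ (h + x)) r₆ es ≤ B → length es ≤ B →
    ∃[ x ] ∃[ y ]
      Exec W (while 9 maximize) (file r₀ p sp h r₅ r₆ r₇ r₈ (length es) len r₁₁ r₁₂ r₁₃ , μ)
           (suc (length es * 14))
           (file r₀ (p + length (flat es)) sp h r₅ (sweep (λ x → μ (h + x)) r₆ es) r₇ r₈ 0 len r₁₁ x y , μ)
  sweep-loop [] {p} {r₆} {r₁₂} {r₁₃} {μ} _ _ _ _ _ _ = r₁₂ , r₁₃ ,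
    retarget (λ q → file r₀ q sp h r₅ r₆ r₇ r₈ 0 len r₁₁ r₁₂ r₁₃)
          (sym (+-identityʳ p)) (while-≡0 refl)
  sweep-loop ((u , v) ∷ es) {p} {r₆} {μ = μ} (hu , hv , hs) p≤B h+n≤B heap≤B sweep≤B l≤B =
    let x , y , ex = sweep-loop es hs 2+p≤B h+n≤B heap≤B sweep≤B l′≤B
    in x , y ,
       retarget (λ q → file r₀ q sp h r₅ (sweep (λ x → μ (h + x)) r₆ ((u , v) ∷ es)) r₇ r₈ 0 len r₁₁ x y)
             (sym shift₂)
             (while-≢0 1+n≢0
               (maximize-step {r₉ = length es} {μ = μ} hu hv (≤-trans (m≤m+n _ _) 2+p≤B)
                 (endpoint≤ u) (endpoint≤ v) (heap≤B _ _)
                 (≤-trans (sweep-≥ _ _ es) sweep≤B) l′≤B) ex)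
    where
    shift₂ : p + suc (suc (length (flat es))) ≡ suc (suc p) + length (flat es)
    shift₂ = trans (+-suc p _) (+-suc (suc p) (length (flat es)))
    2+p≤B : suc (suc p) + length (flat es) ≤ B
    2+p≤B = subst (_≤ B) shift₂ p≤B
    l′≤B : length es ≤ B
    l′≤B = ≤-trans (n≤1+n _) l≤B
    endpoint≤ : ∀ w → h + toℕ w ≤ B
    endpoint≤ w = ≤-trans (+-monoʳ-≤ h (<⇒≤ (toℕ<n w))) h+n≤B

-- Evaluation of decomposition trees

flat-length : ∀ {n} (es : List (Fin n × Fin n)) → length (flat es) ≡ length es + length es
flat-length []       = refl
flat-length (_ ∷ es) = cong suc (trans (cong suc (flat-length es)) (sym (+-suc (length es) (length es))))

flat-< : ∀ {n} (es : List (Fin n × Fin n)) → All (_< n) (flat es)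
flat-< []             = []
flat-< ((u , v) ∷ es) = toℕ<n u ∷ toℕ<n v ∷ flat-< es

sweep-cong : ∀ {n f g} b (es : List (Fin n × Fin n)) → (∀ x → f x ≡ g x) → sweep f b es ≡ sweep g b es
sweep-cong b []             eq = refl
sweep-cong b ((u , v) ∷ es) eq rewrite eq (toℕ u) | eq (toℕ v) = sweep-cong _ es eq

count-above : ∀ {n} x xs → All (_< n) xs → n ≤ x → count x xs ≡ 0
count-above x []       []       _   = refl
count-above x (y ∷ xs) (y<n ∷ p) n≤x rewrite dec-false (x ℕ.≟ y) (λ { refl → <⇒≱ y<n n≤x }) =
  count-above x xs p n≤x

tri-≤ : ∀ n → tri n ≤ n * n
tri-≤ zero    = z≤n
tri-≤ (suc n) = ≤-trans (+-mono-≤ (n≤1+n n) (tri-≤ n)) (+-monoʳ-≤ (suc n) (*-monoʳ-≤ n (n≤1+n n)))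

inner-length : (w₁ w₂ : List ℕ) (x : ℕ) → length (w₁ ++ w₂ ++ [ x ]) ≡ suc (length w₁ + length w₂)
inner-length w₁ w₂ x = begin
  length (w₁ ++ w₂ ++ [ x ])      ≡⟨ length-++ w₁ ⟩
  length w₁ + length (w₂ ++ [ x ]) ≡⟨ cong (length w₁ +_) (length-++ w₂) ⟩
  length w₁ + (length w₂ + 1)     ≡⟨ cong (length w₁ +_) (+-comm (length w₂) 1) ⟩
  length w₁ + suc (length w₂)     ≡⟨ +-suc (length w₁) (length w₂) ⟩
  suc (length w₁ + length w₂)     ∎
  where open ≡-Reasoning

inner-size : (w₁ w₂ : List ℕ) {x n₁ n₂ : ℕ} → 1 ≤ n₁ × suc (length w₁) ≤ 6 * n₁ →
             1 ≤ n₂ × suc (length w₂) ≤ 6 * n₂ →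
             1 ≤ n₁ + n₂ × suc (length (w₁ ++ w₂ ++ [ x ])) ≤ 6 * (n₁ + n₂)
inner-size w₁ w₂ {x} {n₁} {n₂} (1≤n₁ , l₁) (_ , l₂) = ≤-trans 1≤n₁ (m≤m+n n₁ n₂) , (begin
  suc (length (w₁ ++ w₂ ++ [ x ]))     ≡⟨ cong suc (inner-length w₁ w₂ x) ⟩
  suc (suc (length w₁ + length w₂))    ≡⟨ cong suc (+-suc (length w₁) (length w₂)) ⟨
  suc (length w₁) + suc (length w₂)    ≤⟨ +-mono-≤ l₁ l₂ ⟩
  6 * n₁ + 6 * n₂                      ≡⟨ *-distribˡ-+ 6 n₁ n₂ ⟨
  6 * (n₁ + n₂)                        ∎)
  where open ≤-Reasoning

-- The factor 6 comes from a leaf, whose 3 + 2m words and one reserve make 4 + 2m with m ≤ n and n ≥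
-- 1. An inner node spends one of the reserves of its children on its tag.
encodes-size : ∀ {D w} → Encodes D w → 1 ≤ order (eval D) × suc (length w) ≤ 6 * order (eval D)
encodes-size (tree {t} {(1≤n , _) , acyclic} {es} es↭) =
  1≤n , leaf-size 1≤n (forest-size (acyclic⇒forest {t} es↭ acyclic)) (flat-length es)
  where
  leaf-size : ∀ {n m l} → 1 ≤ n → m ≤ n → l ≡ m + m → 4 + l ≤ 6 * n
  leaf-size {n} {m} 1≤n m≤n refl = begin
    4 * 1 + (m + m)  ≤⟨ +-mono-≤ (*-monoʳ-≤ 4 1≤n) (+-mono-≤ m≤n m≤n) ⟩
    4 * n + (n + n)  ≡⟨ eq n ⟩
    6 * n            ∎
    where
    open ≤-Reasoning
    eq : ∀ n → 4 * n + (n + n) ≡ 6 * n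
    eq = solve-∀
encodes-size (cotree {t} {p} es↭) = encodes-size (tree {t} {p} es↭)
encodes-size (_⊕_ {w₁ = w₁} {w₂} e₁ e₂) = inner-size w₁ w₂ (encodes-size e₁) (encodes-size e₂)
encodes-size (_⊗_ {w₁ = w₁} {w₂} e₁ e₂) = inner-size w₁ w₂ (encodes-size e₁) (encodes-size e₂)

record Junk : Set where
  constructor junk
  field
    j₅ j₆ j₇ j₈ j₉ j₁₁ j₁₂ j₁₃ : ℕ

-- The register file between two rounds of the main loop.
idle : (len p sp h : ℕ) → Junk → List ℕ
idle len p sp h (junk j₅ j₆ j₇ j₈ j₉ j₁₁ j₁₂ j₁₃) =
  file (len ∸ p) p sp h j₅ j₆ j₇ j₈ j₉ len j₁₁ j₁₂ j₁₃

-- A run of a loop is only described up to its exit, but a subtree ends between two rounds. Hence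
-- the rounds so far are given as a map that prefixes them to any run of the rest.
record Iter (W : ℕ) (c : Config) (t : ℕ) (c′ : Config) : Set where
  constructor iter
  field
    prefix : ∀ {t′ c″} → Exec W (while 0 body) c′ t′ c″ → Exec W (while 0 body) c (t + t′) c″

open Iter

_⨟_ : ∀ {W c c′ c″ t t′} → Iter W c t c′ → Iter W c′ t′ c″ → Iter W c (t + t′) c″
_⨟_ {W} {c} {t = t} {t′} i j =
  iter λ {_} {c″} e → subst (λ t → Exec W (while 0 body) c t c″) (sym (+-assoc t t′ _)) (prefix i (prefix j e))

pushed : (ℕ → ℕ) → (sp n k : ℕ) → ℕ → ℕ
pushed μ sp n k = (μ [ sp ↦ n ]) [ suc sp ↦ k ]

pushed-other : ∀ μ {sp n k a} → sp ≢ a → suc sp ≢ a → pushed μ sp n k a ≡ μ a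
pushed-other μ {sp} {n} ≢sp ≢1+sp = trans (update-other (μ [ sp ↦ n ]) ≢1+sp) (update-other μ ≢sp)

branch : Program
branch = ifnz 5 (5 ≔ op sub 5 4 ⨾ ifnz 5 inner cotreeLeaf) treeLeaf

module Evaluation {W N : ℕ} (bounded : 8 * N + N * N < W) where

  -- The linear part covers addresses, at most 7N, and sums of two degree counters, at most 4N; the
  -- square covers the indices and the intermediate results in computing them.
  B = 8 * N + N * N

  small : ∀ {x} → x ≤ 8 * N → x ≤ B
  small x≤ = ≤-trans x≤ (m≤m+n (8 * N) (N * N))

  square : ∀ {x n} → n ≤ N → x ≤ n * n → x ≤ B
  square n≤N x≤ = ≤-trans x≤ (≤-trans (*-mono-≤ n≤N n≤N) (m≤n+m (N * N) (8 * N)))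

  fit : ∀ {x} → x ≤ B → x < W
  fit x≤B = ≤-<-trans x≤B bounded

  -- The effect of reading the word of D, which extends from p to p′.
  record Evaluated (len p sp h : ℕ) (js : Junk) (μ : ℕ → ℕ) (D : DecompositionTree) (p′ : ℕ) : Set where
    field
      {time}    : ℕ
      {h′}      : ℕ
      {js′}     : Junk
      {μ′}      : ℕ → ℕ
      {χ}       : ℕ
      run       : Iter W (idle len p sp h js , μ) time (idle len p′ (suc (suc sp)) h′ js′ , μ′)
      -- The slack of 25 steps pays for the parent node.
      time-≤    : time + 25 ≤ 80 * order (eval D)
      opt       : Optimal (eval D) χ
      h≤h′      : h ≤ h′
      h′≤       : h′ ≤ h + order (eval D)
      stack     : ∀ a → a < sp → μ′ a ≡ μ a
      input     : ∀ a → p′ ≤ a → a < len → μ′ a ≡ μ a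
      untouched : ∀ a → h′ ≤ a → μ′ a ≡ 0
      room      : suc (suc sp) ≤ p′
      top-order : μ′ sp ≡ order (eval D)
      top-index : μ′ (suc sp) ≡ χ

  module _ {r₀ p sp h r₅ r₆ r₇ r₈ r₉ len r₁₁ r₁₂ r₁₃ : ℕ} {μ : ℕ → ℕ} where

    fetch-step : ∀ {x} → μ p ≡ x → x ≤ B → suc p ≤ B →
      Exec W (5 ≔ load 1 ⨾ 1 ≔ op add 4 1)
        (file r₀ p sp h r₅ r₆ r₇ r₈ r₉ len r₁₁ r₁₂ r₁₃ , μ) 2
        (file r₀ (suc p) sp h x r₆ r₇ r₈ r₉ len r₁₁ r₁₂ r₁₃ , μ)
    fetch-step refl x≤B p<B = straight _ (fit x≤B , fit p<B)

    header-step : ∀ {n m} → μ p ≡ n → μ (suc p) ≡ m → n ≤ B → m ≤ B → suc (suc p) ≤ B →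
      Exec W header
        (file r₀ p sp h r₅ r₆ r₇ r₈ r₉ len r₁₁ r₁₂ r₁₃ , μ) 4
        (file r₀ (suc (suc p)) sp h r₅ r₆ n m r₉ len r₁₁ r₁₂ r₁₃ , μ)
    header-step refl refl n≤B m≤B p<B = straight header (fit n≤B , fit (<⇒≤ p<B) , fit m≤B , fit p<B)

    pop-step : ∀ {l n₂ k n₁} → μ (suc (suc (suc sp))) ≡ l → μ (suc (suc sp)) ≡ n₂ →
      μ (suc sp) ≡ k → μ sp ≡ n₁ → suc (suc (suc sp)) ≤ B → l ≤ B → n₂ ≤ B → k ≤ B → n₁ ≤ B →
      Exec W pop
        (file r₀ p (suc (suc (suc (suc sp)))) h r₅ r₆ r₇ r₈ r₉ len r₁₁ r₁₂ r₁₃ , μ) 8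
        (file r₀ p sp h r₅ l n₂ k n₁ len r₁₁ r₁₂ r₁₃ , μ)
    pop-step refl refl refl refl sp≤B l≤B n₂≤B k≤B n₁≤B = straight pop
      ( fit sp≤B , fit l≤B , fit (<⇒≤ sp≤B) , fit n₂≤B
      , fit (<⇒≤ (<⇒≤ sp≤B)) , fit k≤B , fit (<⇒≤ (<⇒≤ (<⇒≤ sp≤B))) , fit n₁≤B )

    push-step : suc (suc sp) ≤ B → len ≤ B →
      Exec W push
        (file r₀ p sp h r₅ r₆ r₇ r₈ r₉ len r₁₁ r₁₂ r₁₃ , μ) 5
        (idle len p (suc (suc sp)) h (junk r₅ r₆ r₇ r₈ r₉ r₁₁ r₁₂ r₁₃) , pushed μ sp r₇ r₆)
    push-step sp≤B len≤B = straight push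
      (tt , fit (<⇒≤ sp≤B) , tt , fit sp≤B , fit (≤-trans (m∸n≤m len p) len≤B))

  -- One round of the main loop: the test, the fetch of the tag and the push add 1 + 2 + 5 steps to
  -- the branch.
  turn : ∀ {len p sp h j₅ j₆ j₇ j₈ j₉ j₁₁ j₁₂ j₁₃ μ tag t p′ sp′ h′ r₅ k n r₈ r₉ r₁₁ r₁₂ r₁₃ μ′} →
    p < len → len ≤ B → μ p ≡ tag → tag ≤ B → suc (suc sp′) ≤ B →
    Exec W branch (file (len ∸ p) (suc p) sp h tag j₆ j₇ j₈ j₉ len j₁₁ j₁₂ j₁₃ , μ) t
                  (file (len ∸ p) p′ sp′ h′ r₅ k n r₈ r₉ len r₁₁ r₁₂ r₁₃ , μ′) →
    Iter W (idle len p sp h (junk j₅ j₆ j₇ j₈ j₉ j₁₁ j₁₂ j₁₃) , μ) (suc (2 + (t + 5)))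
           (idle len p′ (suc (suc sp′)) h′ (junk r₅ k n r₈ r₉ r₁₁ r₁₂ r₁₃) , pushed μ′ sp′ n k)
  turn p<len len≤B tag tag≤B sp≤B ex = iter (while-≢0 (m>n⇒m∸n≢0 p<len)
    (fetch-step tag tag≤B (≤-trans p<len len≤B) then ex then push-step sp≤B len≤B))

  -- The push writes only to `sp` and `suc sp`. These cells lie above the older stack and, by
  -- `suc (suc sp) ≤ p′ ≤ len ≤ h`, below the unread input and the heap, so the claims about those
  -- regions survive.
  settle : ∀ {len p sp h js μ D p′ time h′ js′ μ′ n k} →
    Iter W (idle len p sp h js , μ) time (idle len p′ (suc (suc sp)) h′ js′ , pushed μ′ sp n k) →
    time + 25 ≤ 80 * order (eval D) → n ≡ order (eval D) → Optimal (eval D) k →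
    h ≤ h′ → h′ ≤ h + order (eval D) → suc (suc sp) ≤ p′ → p′ ≤ len → len ≤ h →
    (∀ a → a < sp → μ′ a ≡ μ a) → (∀ a → p′ ≤ a → a < len → μ′ a ≡ μ a) →
    (∀ a → h′ ≤ a → μ′ a ≡ 0) → Evaluated len p sp h js μ D p′
  settle {sp = sp} {μ′ = μ′} {n} run time-≤ n≡ opt h≤h′ h′≤ sp<p′ p′≤len len≤h stack input untouched = record
    { run       = run
    ; time-≤    = time-≤
    ; opt       = opt
    ; h≤h′      = h≤h′
    ; h′≤       = h′≤
    ; stack     = λ a a<sp →
        trans (pushed-other μ′ (≢-sym (<⇒≢ a<sp)) (≢-sym (<⇒≢ (m<n⇒m<1+n a<sp)))) (stack a a<sp)
    ; input     = λ a p′≤a a<len → trans (above (≤-trans sp<p′ p′≤a)) (input a p′≤a a<len)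
    ; untouched = λ a h′≤a →
        trans (above (≤-trans sp<p′ (≤-trans p′≤len (≤-trans len≤h (≤-trans h≤h′ h′≤a))))) (untouched a h′≤a)
    ; room      = sp<p′
    ; top-order = trans (update-other (μ′ [ sp ↦ n ]) (≢-sym (<⇒≢ (n<1+n sp)))) (trans (update-same μ′ sp) n≡)
    ; top-index = update-same (μ′ [ sp ↦ n ]) (suc sp)
    }
    where
    above : ∀ {a k} → suc (suc sp) ≤ a → pushed μ′ sp n k a ≡ μ′ a
    above sp<a = pushed-other μ′ (<⇒≢ (<⇒≤ sp<a)) (<⇒≢ sp<a)

  module LeafWord {t : Graph} (isTree : IsTree t) {es : List (Vertex t × Vertex t)} (es↭ : es ↭ edges t)
    {tag len p sp h : ℕ} {js : Junk} {μ : ℕ → ℕ}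
    (n≤N : order t ≤ N) (len≤B : len ≤ B) (holds : Holds μ p (tag ∷ treeWord t es)) (sp≤p : sp ≤ p)
    (word≤ : p + length (tag ∷ treeWord t es) ≤ len) (len≤h : len ≤ h)
    (zeros : ∀ a → h ≤ a → μ a ≡ 0) (h+n≤ : h + order t ≤ 7 * N) where

    open Junk js

    n m L p₃ : ℕ
    n  = order t
    m  = length es
    L  = length (flat es)
    p₃ = suc (suc (suc p))

    p-tag   = proj₁ holds
    p-n     = proj₁ (proj₂ holds)
    p-m     = proj₁ (proj₂ (proj₂ holds))
    p-edges = proj₂ (proj₂ (proj₂ holds))

    1≤n : 1 ≤ n
    1≤n = proj₁ (proj₁ isTree)

    m≤n : m ≤ n
    m≤n = forest-size (acyclic⇒forest {t} es↭ (proj₂ isTree))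

    end-eq : p + length (tag ∷ treeWord t es) ≡ p₃ + L
    end-eq = trans (+-suc p _) (cong suc (trans (+-suc p _) (cong suc (+-suc p L))))

    end≤len : p₃ + L ≤ len
    end≤len = subst (_≤ len) end-eq word≤

    p₃≤len : p₃ ≤ len
    p₃≤len = ≤-trans (m≤m+n p₃ L) end≤len

    p₃≤B : p₃ ≤ B
    p₃≤B = ≤-trans p₃≤len len≤B

    h+n≤B : h + n ≤ B
    h+n≤B = small (≤-trans h+n≤ (*-monoˡ-≤ N (n≤1+n 7)))

    n≤B : n ≤ B
    n≤B = small (≤-trans n≤N (m≤m+n N (7 * N)))

    m≤B : m ≤ B
    m≤B = ≤-trans m≤n n≤B

    L≤2N : L ≤ 2 * N
    L≤2N = begin
      L          ≡⟨ flat-length es ⟩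
      m + m      ≤⟨ +-mono-≤ m≤N (≤-trans m≤N (m≤m+n N 0)) ⟩
      2 * N      ∎
      where
      open ≤-Reasoning
      m≤N = ≤-trans m≤n n≤N

    m+m≤B : m + m ≤ B
    m+m≤B = small (≤-trans (≤-reflexive (sym (flat-length es))) (≤-trans L≤2N (*-monoˡ-≤ N (m≤m+n 2 6))))

    room : suc (suc sp) ≤ p₃ + L
    room = ≤-trans (s≤s (s≤s sp≤p)) (≤-trans (n≤1+n _) (m≤m+n p₃ L))

    room≤B : suc (suc sp) ≤ B
    room≤B = ≤-trans room (≤-trans end≤len len≤B)

    p<len : p < len
    p<len = <⇒≤ (<⇒≤ p₃≤len)

  module _ {t : Graph} (isTree : IsTree t) {es : List (Vertex t × Vertex t)} (es↭ : es ↭ edges t)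
    {len p sp h : ℕ} {js : Junk} {μ : ℕ → ℕ}
    (n≤N : order t ≤ N) (len≤B : len ≤ B) (holds : Holds μ p (0 ∷ treeWord t es)) (sp≤p : sp ≤ p)
    (word≤ : p + length (0 ∷ treeWord t es) ≤ len) (len≤h : len ≤ h)
    (zeros : ∀ a → h ≤ a → μ a ≡ 0) (h+n≤ : h + order t ≤ 7 * N) where

    private
      open LeafWord {t} isTree {es} es↭ {0} {len} {p} {sp} {h} {js} {μ} n≤N len≤B holds sp≤p word≤ len≤h zeros h+n≤
      open Junk js
      module Loop = Loops {W} {B} bounded {len ∸ p} {sp} {h} {0} {n} {m} {len} {p₃}

      tallied = Loop.tally-loop (flat es) {p₃} {j₆} {j₁₂} {j₁₃} {μ} {n}
        p-edges (≤-trans end≤len len≤h) (flat-< es) h+n≤B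
        λ a → subst (λ x → x + L ≤ B) (sym (zeros (h + a) (m≤m+n h a)))
                (small (≤-trans L≤2N (*-monoˡ-≤ N (m≤m+n 2 6))))

      x₁ y₁ : ℕ
      x₁ = proj₁ tallied
      y₁ = proj₁ (proj₂ tallied)
      μ₁ : ℕ → ℕ
      μ₁ = proj₁ (proj₂ (proj₂ tallied))
      tally-run = proj₁ (proj₂ (proj₂ (proj₂ tallied)))
      below = proj₁ (proj₂ (proj₂ (proj₂ (proj₂ tallied))))

      degrees : ∀ a → μ₁ (h + a) ≡ count a (flat es)
      degrees a = trans (proj₂ (proj₂ (proj₂ (proj₂ (proj₂ tallied)))) a)
        (cong (_+ count a (flat es)) (zeros (h + a) (m≤m+n h a)))

      χ : ℕ
      χ = sweep (λ a → μ₁ (h + a)) 0 es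

      opt : Optimal t χ
      opt = subst (Optimal t) (sym (sweep-cong 0 es degrees)) (tree-optimal {t} es↭ (proj₂ isTree))

      χ≤B : χ ≤ B
      χ≤B = square n≤N (optimal-≤ {t} opt)

      degree-sums : ∀ x y → μ₁ (h + x) + μ₁ (h + y) ≤ B
      degree-sums x y = small (≤-trans (+-mono-≤ (degree≤ x) (degree≤ y))
        (≤-trans (≤-reflexive (sym (*-distribʳ-+ N 2 2))) (*-monoˡ-≤ N (m≤m+n 4 4))))
        where
        degree≤ : ∀ x → μ₁ (h + x) ≤ 2 * N
        degree≤ x = subst (_≤ 2 * N) (sym (degrees x)) (≤-trans (count-≤ x (flat es)) L≤2N)

      swept = Loop.sweep-loop es {p₃} {0} {x₁} {y₁} {μ₁}
        (holds-cong p₃ (flat es) (λ b _ b< → below b (<-≤-trans b< (≤-trans end≤len len≤h))) p-edges)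
        (≤-trans end≤len len≤B) h+n≤B degree-sums χ≤B m≤B

      branch-run :
        Exec W branch (file (len ∸ p) (suc p) sp h 0 j₆ j₇ j₈ j₉ len j₁₁ j₁₂ j₁₃ , μ)
          (suc (4 + (2 + (suc (L * 8) + (3 + (suc (m * 14) + 1))))))
          (file (len ∸ p) (p₃ + L) sp (h + n) 0 χ n m 0 len p₃ (proj₁ swept) (proj₁ (proj₂ swept)) , μ₁)
      branch-run =
        ifnz-≡0 refl
          ( header-step p-n p-m n≤B m≤B p₃≤B
          then straight (11 ≔ reg 1 ⨾ 9 ≔ op add 8 8) (fit p₃≤B , fit m+m≤B)
          then resource (λ c → file (len ∸ p) p₃ sp h 0 j₆ n m c len p₃ j₁₂ j₁₃) (flat-length es) tally-run
          then straight (1 ≔ reg 11 ⨾ 6 ≔ const 0 ⨾ 9 ≔ reg 8) (fit p₃≤B , fit z≤n , fit m≤B)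
          then proj₂ (proj₂ swept)
          then straight (3 ≔ op add 3 7) (fit h+n≤B) )

      time : suc (2 + (suc (4 + (2 + (suc (L * 8) + (3 + (suc (m * 14) + 1))))) + 5)) + 25 ≤ 80 * n
      time = begin
        suc (2 + (suc (4 + (2 + (suc (L * 8) + (3 + (suc (m * 14) + 1))))) + 5)) + 25
          ≡⟨ cong (λ l → suc (2 + (suc (4 + (2 + (suc (l * 8) + (3 + (suc (m * 14) + 1))))) + 5)) + 25)
               (flat-length es) ⟩
        suc (2 + (suc (4 + (2 + (suc ((m + m) * 8) + (3 + (suc (m * 14) + 1))))) + 5)) + 25
          ≡⟨ lemma m ⟩
        -- An edge costs 8 for either endpoint and 14 in the second pass. The constant 46 contains
        -- the reserve of 25; rounded up, this leaf bound yields the factor 80.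
        46 * 1 + 30 * m ≤⟨ +-mono-≤ (*-mono-≤ (m≤m+n 46 4) 1≤n) (*-monoʳ-≤ 30 m≤n) ⟩
        50 * n + 30 * n ≡⟨ *-distribʳ-+ n 50 30 ⟨
        80 * n ∎
        where
        open ≤-Reasoning
        lemma : ∀ m → suc (2 + (suc (4 + (2 + (suc ((m + m) * 8) + (3 + (suc (m * 14) + 1))))) + 5)) + 25
                      ≡ 46 * 1 + 30 * m
        lemma = solve-∀

      untouched : ∀ a → h + n ≤ a → μ₁ a ≡ 0
      -- Vertex labels are below `n`, so the counters from `h + n` on have never been raised.
      untouched a h+n≤a = trans (cong μ₁ (sym (m+[n∸m]≡n (≤-trans (m≤m+n h n) h+n≤a))))
        (trans (degrees (a ∸ h)) (count-above (a ∸ h) (flat es) (flat-< es) (m+n≤o⇒m≤o∸n n (subst (_≤ a) (+-comm h n) h+n≤a))))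

    evaluate-tree : Evaluated len p sp h js μ (tree t isTree) (p + length (0 ∷ treeWord t es))
    evaluate-tree = subst (Evaluated len p sp h js μ (tree t isTree)) (sym end-eq)
      (settle (turn p<len len≤B p-tag z≤n room≤B branch-run) time refl opt
        (m≤m+n h n) ≤-refl room end≤len len≤h
        (λ a a<sp → below a (<-≤-trans a<sp (≤-trans sp≤p (≤-trans (<⇒≤ p<len) len≤h))))
        (λ a _ a<len → below a (<-≤-trans a<len len≤h))
        untouched)

  module _ {t : Graph} (isTree : IsTree t) {es : List (Vertex t × Vertex t)} (es↭ : es ↭ edges t)
    {len p sp h : ℕ} {js : Junk} {μ : ℕ → ℕ}
    (n≤N : order t ≤ N) (len≤B : len ≤ B) (holds : Holds μ p (1 ∷ treeWord t es)) (sp≤p : sp ≤ p)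
    (word≤ : p + length (1 ∷ treeWord t es) ≤ len) (len≤h : len ≤ h)
    (zeros : ∀ a → h ≤ a → μ a ≡ 0) (h+n≤ : h + order t ≤ 7 * N) where

    private
      open LeafWord {t} isTree {es} es↭ {1} {len} {p} {sp} {h} {js} {μ} n≤N len≤B holds sp≤p word≤ len≤h zeros h+n≤
      open Junk js
      module Loop = Loops {W} {B} bounded {len ∸ p} {sp} {h} {0} {n} {m} {len} {j₁₁}

      p′ : ℕ
      p′ = p₃ + m + m

      end-eq′ : p₃ + L ≡ p′
      end-eq′ = trans (cong (p₃ +_) (flat-length es)) (sym (+-assoc p₃ m m))

      p′≤B : p′ ≤ B
      p′≤B = subst (_≤ B) end-eq′ (≤-trans end≤len len≤B)

      χ : ℕ
      -- The `0` is the start value of the accumulating register.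
      χ = tri n + 0 ∸ m

      opt : Optimal (complement t) χ
      opt = subst (λ x → Optimal (complement t) (x ∸ m)) (sym (+-identityʳ (tri n)))
              (cotree-optimal {t} (proj₂ isTree) es↭)

      tri≤B : tri n + 0 ≤ B
      tri≤B = square n≤N (subst (_≤ n * n) (sym (+-identityʳ (tri n))) (tri-≤ n))

      branch-run :
        Exec W branch (file (len ∸ p) (suc p) sp h 1 j₆ j₇ j₈ j₉ len j₁₁ j₁₂ j₁₃ , μ)
          (suc (1 + suc (4 + (4 + (suc (n * 3) + 1)))))
          (file (len ∸ p) p′ sp h 0 χ n m 0 len j₁₁ j₁₂ j₁₃ , μ)
      branch-run =
        ifnz-≢0 1+n≢0 (straight (5 ≔ op sub 5 4) (fit z≤n) then ifnz-≡0 refl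
          ( header-step p-n p-m n≤B m≤B p₃≤B
          then straight (1 ≔ op add 1 8 ⨾ 1 ≔ op add 1 8 ⨾ 6 ≔ const 0 ⨾ 9 ≔ reg 7)
                 (fit (≤-trans (m≤m+n (p₃ + m) m) p′≤B) , fit p′≤B , fit z≤n , fit n≤B)
          then Loop.tri-loop n {p′} {0} {j₁₂} {j₁₃} {μ} n≤B tri≤B
          then straight (6 ≔ op sub 6 8) (fit (≤-trans (m∸n≤m _ m) tri≤B)) ))

      time : suc (2 + (suc (1 + suc (4 + (4 + (suc (n * 3) + 1)))) + 5)) + 25 ≤ 80 * n
      time = begin
        suc (2 + (suc (1 + suc (4 + (4 + (suc (n * 3) + 1)))) + 5)) + 25 ≡⟨ lemma n ⟩
        46 * 1 + 3 * n ≤⟨ +-mono-≤ (*-mono-≤ (m≤m+n 46 31) 1≤n) ≤-refl ⟩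
        77 * n + 3 * n ≡⟨ *-distribʳ-+ n 77 3 ⟨
        80 * n ∎
        where
        open ≤-Reasoning
        lemma : ∀ n → suc (2 + (suc (1 + suc (4 + (4 + (suc (n * 3) + 1)))) + 5)) + 25 ≡ 46 * 1 + 3 * n
        lemma = solve-∀

    evaluate-cotree : Evaluated len p sp h js μ (cotree t isTree) (p + length (1 ∷ treeWord t es))
    evaluate-cotree = subst (Evaluated len p sp h js μ (cotree t isTree)) (sym (trans end-eq end-eq′))
      (settle (turn p<len len≤B p-tag tag≤B room≤B branch-run) time refl opt
        ≤-refl (m≤m+n h n) (subst (suc (suc sp) ≤_) end-eq′ room) (subst (_≤ len) end-eq′ end≤len) len≤h
        (λ _ _ → refl) (λ _ _ _ → refl) zeros)
      where
      tag≤B : 1 ≤ B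
      tag≤B = ≤-trans (s≤s z≤n) room≤B

  -- What the tag x does to the indices k and l on the stack.
  record Merge (D₁ D₂ D : DecompositionTree) (x k l : ℕ) : Set where
    field
      {χ r₅′ r₈′ time} : ℕ
      time-≤ : time ≤ 17
      opt    : Optimal (eval D) χ
      effect : ∀ {r₀ p sp h r₆ r₇ r₈ r₉ len r₁₁ r₁₂ r₁₃ μ} →
        μ (suc (suc (suc sp))) ≡ l → μ (suc (suc sp)) ≡ order (eval D₂) →
        μ (suc sp) ≡ k → μ sp ≡ order (eval D₁) → suc (suc (suc (suc sp))) ≤ B →
        Exec W branch
          (file r₀ p (suc (suc (suc (suc sp)))) h x r₆ r₇ r₈ r₉ len r₁₁ r₁₂ r₁₃ , μ) time
          (file r₀ p sp h r₅′ χ (order (eval D₁) + order (eval D₂)) r₈′ (order (eval D₁)) len r₁₁ r₁₂ r₁₃ , μ)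

  module _ {D₁ D₂ : DecompositionTree} {k l : ℕ} (n≤N : order (eval D₁) + order (eval D₂) ≤ N)
           (o₁ : Optimal (eval D₁) k) (o₂ : Optimal (eval D₂) l) where

    private
      n₁ n₂ : ℕ
      n₁ = order (eval D₁)
      n₂ = order (eval D₂)
      n₁≤N : n₁ ≤ N
      n₁≤N = ≤-trans (m≤m+n n₁ n₂) n≤N
      n₂≤N : n₂ ≤ N
      n₂≤N = ≤-trans (m≤n+m n₂ n₁) n≤N
      N≤B : ∀ {n} → n ≤ N → n ≤ B
      N≤B n≤N = small (≤-trans n≤N (m≤m+n N (7 * N)))
      k≤B : k ≤ B
      k≤B = square n₁≤N (optimal-≤ {eval D₁} o₁)
      l≤B : l ≤ B
      l≤B = square n₂≤N (optimal-≤ {eval D₂} o₂)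
      ⊕≤B : l + (k ∸ l) ≤ B
      ⊕≤B = square n≤N (optimal-≤ {eval (D₁ ⊕ D₂)} (disjointUnion-optimal o₁ o₂))
      ⊗≤B : k + l + n₁ * n₂ ≤ B
      ⊗≤B = square n≤N (optimal-≤ {eval (D₁ ⊗ D₂)} (join-optimal o₁ o₂))

    merge-⊕ : Merge D₁ D₂ (D₁ ⊕ D₂) 2 k l
    merge-⊕ = record
      { time-≤ = n≤1+n 16
      ; opt    = disjointUnion-optimal o₁ o₂
      ; effect = λ l≡ n₂≡ k≡ n₁≡ sp≤B →
          ifnz-≢0 1+n≢0 (straight (5 ≔ op sub 5 4) (fit (≤-trans (s≤s z≤n) sp≤B)) then
          ifnz-≢0 1+n≢0 (straight (5 ≔ op sub 5 4) (fit z≤n)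
            then pop-step l≡ n₂≡ k≡ n₁≡ (<⇒≤ sp≤B) l≤B (N≤B n₂≤N) k≤B (N≤B n₁≤N)
            then ifnz-≡0 refl (straight (8 ≔ op sub 8 6 ⨾ 6 ≔ op add 6 8)
                   (fit (≤-trans (m∸n≤m k l) k≤B) , fit ⊕≤B))
            then straight (7 ≔ op add 9 7) (fit (N≤B n≤N))))
      }

    merge-⊗ : Merge D₁ D₂ (D₁ ⊗ D₂) 3 k l
    merge-⊗ = record
      { time-≤ = ≤-refl
      ; opt    = join-optimal o₁ o₂
      ; effect = λ l≡ n₂≡ k≡ n₁≡ sp≤B →
          ifnz-≢0 1+n≢0 (straight (5 ≔ op sub 5 4) (fit (≤-trans (s≤s (s≤s z≤n)) sp≤B)) then
          ifnz-≢0 1+n≢0 (straight (5 ≔ op sub 5 4) (fit (≤-trans (s≤s z≤n) sp≤B))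
            then pop-step l≡ n₂≡ k≡ n₁≡ (<⇒≤ sp≤B) l≤B (N≤B n₂≤N) k≤B (N≤B n₁≤N)
            then ifnz-≢0 1+n≢0 (straight (6 ≔ op add 8 6 ⨾ 8 ≔ op mul 9 7 ⨾ 6 ≔ op add 6 8)
                   (fit (≤-trans (m≤m+n (k + l) _) ⊗≤B) , fit (≤-trans (m≤n+m _ (k + l)) ⊗≤B) , fit ⊗≤B))
            then straight (7 ≔ op add 9 7) (fit (N≤B n≤N))))
      }

  open Evaluated hiding (time)

  evaluate-inner : ∀ {D₁ D₂ D x len p sp h js μ p₁ p₂} →
    order (eval D) ≡ order (eval D₁) + order (eval D₂) → len ≤ B → len ≤ h →
    (E₁ : Evaluated len p sp h js μ D₁ p₁) →
    (E₂ : Evaluated len p₁ (suc (suc sp)) (h′ E₁) (js′ E₁) (μ′ E₁) D₂ p₂) →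
    p₁ ≤ p₂ → p₂ < len → μ p₂ ≡ x → x ≤ 3 → Merge D₁ D₂ D x (χ E₁) (χ E₂) →
    Evaluated len p sp h js μ D (suc p₂)
  evaluate-inner {D₁} {D₂} {D} {x} {len} {p} {sp} {h} {js} {μ} {p₁} {p₂}
                 n≡ len≤B len≤h E₁ E₂ p₁≤p₂ p₂<len tag x≤3 M =
    settle (run E₁ ⨟ (run E₂ ⨟ turn p₂<len len≤B tag′ (≤-trans x≤3 (≤-trans (m≤m+n 3 (suc sp)) sp≤B)) (<⇒≤ (<⇒≤ sp≤B))
             (Merge.effect M (top-index E₂) (top-order E₂)
               (trans (stack E₂ (suc sp) ≤-refl) (top-index E₁))
               (trans (stack E₂ sp (n≤1+n (suc sp))) (top-order E₁)) sp≤B)))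
      time (sym n≡) (Merge.opt M) (≤-trans (h≤h′ E₁) (h≤h′ E₂)) h″≤
      (≤-trans (n≤1+n _) (≤-trans (<⇒≤ (room E₂)) (n≤1+n p₂))) p₂<len len≤h
      (λ a a<sp → trans (stack E₂ a (<-trans a<sp (<-trans (n<1+n sp) (n<1+n (suc sp))))) (stack E₁ a a<sp))
      (λ a p₂<a → unread a (<⇒≤ p₂<a))
      (untouched E₂)
    where
    unread : ∀ a → p₂ ≤ a → a < len → μ′ E₂ a ≡ μ a
    unread a p₂≤a a<len = trans (input E₂ a p₂≤a a<len) (input E₁ a (≤-trans p₁≤p₂ p₂≤a) a<len)
    tag′ : μ′ E₂ p₂ ≡ x
    tag′ = trans (unread p₂ ≤-refl p₂<len) tag
    sp≤B : suc (suc (suc (suc sp))) ≤ B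
    sp≤B = ≤-trans (room E₂) (≤-trans (<⇒≤ p₂<len) len≤B)
    n₁ n₂ : ℕ
    n₁ = order (eval D₁)
    n₂ = order (eval D₂)
    h″≤ : h′ E₂ ≤ h + order (eval D)
    h″≤ = begin
      h′ E₂           ≤⟨ h′≤ E₂ ⟩
      h′ E₁ + n₂      ≤⟨ +-monoˡ-≤ n₂ (h′≤ E₁) ⟩
      h + n₁ + n₂     ≡⟨ +-assoc h n₁ n₂ ⟩
      h + (n₁ + n₂)   ≡⟨ cong (h +_) n≡ ⟨
      h + order (eval D) ∎
      where open ≤-Reasoning
    time : Evaluated.time E₁ + (Evaluated.time E₂ + suc (2 + (Merge.time M + 5))) + 25 ≤ 80 * order (eval D)
    time = begin
      t₁ + (t₂ + suc (2 + (Merge.time M + 5))) + 25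
        -- At most 17 steps for the branch and 8 around it make 25, the reserve of one child; that
        -- of the other is left for the parent.
        ≤⟨ +-monoˡ-≤ 25 (+-monoʳ-≤ t₁ (+-monoʳ-≤ t₂ (s≤s (+-monoʳ-≤ 2 (+-monoˡ-≤ 5 (Merge.time-≤ M)))))) ⟩
      t₁ + (t₂ + 25) + 25        ≡⟨ lemma t₁ t₂ ⟩
      (t₁ + 25) + (t₂ + 25)      ≤⟨ +-mono-≤ (time-≤ E₁) (time-≤ E₂) ⟩
      80 * n₁ + 80 * n₂          ≡⟨ *-distribˡ-+ 80 n₁ n₂ ⟨
      80 * (n₁ + n₂)             ≡⟨ cong (80 *_) n≡ ⟨
      80 * order (eval D)        ∎
      where
      open ≤-Reasoning
      t₁ = Evaluated.time E₁
      t₂ = Evaluated.time E₂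
      lemma : ∀ t₁ t₂ → t₁ + (t₂ + 25) + 25 ≡ (t₁ + 25) + (t₂ + 25)
      lemma = solve-∀

  module Children {D₁ D₂ : DecompositionTree} (w₁ w₂ : List ℕ) {x len p h : ℕ} {μ : ℕ → ℕ}
    (n≤N : order (eval D₁) + order (eval D₂) ≤ N) (holds : Holds μ p (w₁ ++ w₂ ++ [ x ]))
    (word≤ : p + length (w₁ ++ w₂ ++ [ x ]) ≤ len)
    (h+n≤ : h + (order (eval D₁) + order (eval D₂)) ≤ 7 * N) where

    n₁ n₂ p₁ p₂ : ℕ
    n₁ = order (eval D₁)
    n₂ = order (eval D₂)
    p₁ = p + length w₁
    p₂ = p₁ + length w₂

    n₁≤N : n₁ ≤ N
    n₁≤N = ≤-trans (m≤m+n n₁ n₂) n≤N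

    n₂≤N : n₂ ≤ N
    n₂≤N = ≤-trans (m≤n+m n₂ n₁) n≤N

    end-eq : p + length (w₁ ++ w₂ ++ [ x ]) ≡ suc p₂
    end-eq = trans (cong (p +_) (inner-length w₁ w₂ x))
      (trans (+-suc p _) (cong suc (sym (+-assoc p (length w₁) (length w₂)))))

    p₂<len : p₂ < len
    p₂<len = subst (_≤ len) end-eq word≤

    p₁≤p₂ : p₁ ≤ p₂
    p₁≤p₂ = m≤m+n p₁ (length w₂)

    holds₁ : Holds μ p w₁
    holds₁ = proj₁ (holds-++ p w₁ holds)

    holds₂ : Holds μ p₁ w₂
    holds₂ = proj₁ (holds-++ p₁ w₂ (proj₂ (holds-++ p w₁ holds)))

    p₂-tag : μ p₂ ≡ x
    p₂-tag = proj₁ (proj₂ (holds-++ p₁ w₂ (proj₂ (holds-++ p w₁ holds))))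

    h+n₁≤ : h + n₁ ≤ 7 * N
    h+n₁≤ = ≤-trans (+-monoʳ-≤ h (m≤m+n n₁ n₂)) h+n≤

    h₁+n₂≤ : ∀ {h₁} → h₁ ≤ h + n₁ → h₁ + n₂ ≤ 7 * N
    h₁+n₂≤ h₁≤ = ≤-trans (+-monoˡ-≤ n₂ h₁≤) (subst (_≤ 7 * N) (sym (+-assoc h n₁ n₂)) h+n≤)

    holds₂′ : ∀ {μ′} → (∀ a → p₁ ≤ a → a < len → μ′ a ≡ μ a) → Holds μ′ p₁ w₂
    holds₂′ same = holds-cong p₁ w₂ (λ b p₁≤b b< → same b p₁≤b (<-trans b< p₂<len)) holds₂

  -- Induction along the postorder word. The second child starts on a stack two cells higher and a
  -- heap advanced by at most the order of the first; its word is still intact because the first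
  -- child preserves the unread input.
  evaluate : ∀ {D w} → Encodes D w → ∀ {len p sp h js μ} → order (eval D) ≤ N → len ≤ B →
    Holds μ p w → sp ≤ p → p + length w ≤ len → len ≤ h → (∀ a → h ≤ a → μ a ≡ 0) →
    h + order (eval D) ≤ 7 * N → Evaluated len p sp h js μ D (p + length w)
  evaluate (tree {t} {isTree} es↭)   = evaluate-tree isTree es↭
  evaluate (cotree {t} {isTree} es↭) = evaluate-cotree isTree es↭
  evaluate (_⊕_ {D₁} {D₂} {w₁} {w₂} e₁ e₂) {len} {p} {sp} {h} {js} {μ}
           n≤N len≤B holds sp≤p word≤ len≤h zeros h+n≤ =
    subst (Evaluated len p sp h js μ (D₁ ⊕ D₂)) (sym end-eq)
      (evaluate-inner {D = D₁ ⊕ D₂} refl len≤B len≤h E₁ E₂ p₁≤p₂ p₂<len p₂-tag (n≤1+n 2)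
        (merge-⊕ {D₁} {D₂} n≤N (opt E₁) (opt E₂)))
    where
    open Children {D₁} {D₂} w₁ w₂ {h = h} {μ = μ} n≤N holds word≤ h+n≤
    E₁ : Evaluated len p sp h js μ D₁ p₁
    E₁ = evaluate e₁ n₁≤N len≤B holds₁ sp≤p (≤-trans p₁≤p₂ (<⇒≤ p₂<len)) len≤h zeros h+n₁≤
    E₂ : Evaluated len p₁ (suc (suc sp)) (h′ E₁) (js′ E₁) (μ′ E₁) D₂ p₂
    E₂ = evaluate e₂ n₂≤N len≤B (holds₂′ (input E₁)) (room E₁) (<⇒≤ p₂<len) (≤-trans len≤h (h≤h′ E₁))
           (untouched E₁) (h₁+n₂≤ (h′≤ E₁))
  evaluate (_⊗_ {D₁} {D₂} {w₁} {w₂} e₁ e₂) {len} {p} {sp} {h} {js} {μ}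
           n≤N len≤B holds sp≤p word≤ len≤h zeros h+n≤ =
    subst (Evaluated len p sp h js μ (D₁ ⊗ D₂)) (sym end-eq)
      (evaluate-inner {D = D₁ ⊗ D₂} refl len≤B len≤h E₁ E₂ p₁≤p₂ p₂<len p₂-tag ≤-refl
        (merge-⊗ {D₁} {D₂} n≤N (opt E₁) (opt E₂)))
    where
    open Children {D₁} {D₂} w₁ w₂ {h = h} {μ = μ} n≤N holds word≤ h+n≤
    E₁ : Evaluated len p sp h js μ D₁ p₁
    E₁ = evaluate e₁ n₁≤N len≤B holds₁ sp≤p (≤-trans p₁≤p₂ (<⇒≤ p₂<len)) len≤h zeros h+n₁≤
    E₂ : Evaluated len p₁ (suc (suc sp)) (h′ E₁) (js′ E₁) (μ′ E₁) D₂ p₂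
    E₂ = evaluate e₂ n₂≤N len≤B (holds₂′ (input E₁)) (room E₁) (<⇒≤ p₂<len) (≤-trans len≤h (h≤h′ E₁))
           (untouched E₁) (h₁+n₂≤ (h′≤ E₁))

-- Initial configuration, word size and the complete run

zeros : ∀ k r → cells (List.replicate k 0) r ≡ 0
zeros zero    r       = refl
zeros (suc k) zero    = refl
zeros (suc k) (suc r) = zeros k r

start-config : List ℕ → Config
start-config w = length w ∷ List.replicate 13 0 , cells w

initial-∼ : ∀ w → initial w ∼ start-config w
initial-∼ w = (λ { zero → refl ; (suc r) → sym (zeros 13 r) }) , refl

-- With `M ≥ 2` the factor 16 is absorbed by `M ^ 4`, which leads to the exponent 6.
power-bound : ∀ N → 1 ≤ N → 8 * N + N * N < suc N ^ 6
power-bound N 1≤N = begin-strict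
  8 * N + N * N              ≤⟨ +-mono-≤ (*-monoʳ-≤ 8 (n≤1+n N)) (*-mono-≤ (n≤1+n N) (n≤1+n N)) ⟩
  8 * M + M * M              <⟨ +-monoˡ-< (M * M) (*-monoˡ-< M (n<1+n 8)) ⟩
  9 * M + M * M              ≤⟨ +-monoˡ-≤ (M * M) (*-monoʳ-≤ 9 (m≤m*n M M)) ⟩
  9 * (M * M) + M * M        ≡⟨ lemma (M * M) ⟩
  10 * (M * M)               ≤⟨ *-monoˡ-≤ (M * M) (m≤m+n 10 6) ⟩
  16 * (M * M)               ≡⟨ lemma′ M ⟩
  M * (M * (2 ^ 4))          ≤⟨ *-monoʳ-≤ M (*-monoʳ-≤ M (^-monoˡ-≤ 4 (s≤s 1≤N))) ⟩
  M ^ 6 ∎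
  where
  open ≤-Reasoning
  M = suc N
  lemma : ∀ x → 9 * x + x ≡ 10 * x
  lemma = solve-∀
  lemma′ : ∀ x → 16 * (x * x) ≡ x * (x * (2 ^ 4))
  lemma′ = solve-∀

theorem4 : ∃[ P ] ∃[ c ] ∃[ d ]
    ((G : Graph) (D : DecompositionTree) →
    TreeCograph G → D IsDecompositionTreeOf G →
    ComputesStrongChromaticIndex P c d G D)
theorem4 = program , 80 , 6 , computes
  where
  computes : (G : Graph) (D : DecompositionTree) → TreeCograph G → D IsDecompositionTreeOf G →
             ComputesStrongChromaticIndex program 80 6 G D
  computes G D _ D≅G w e =
    time , s , subst (λ n → Run (suc n ^ 6) program (initial w) time s) n≡ (proj₁ (proj₂ result)) ,
    time≤ , subst (IsStrongChromaticIndex G) (sym out) (optimal⇒index (≅-optimal D≅G (Evaluated.opt E)))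
    where
    N W : ℕ
    N = order (eval D)
    W = suc N ^ 6
    n≡ : N ≡ order G
    n≡ = ↔⇒≡ (_≅_.bijection D≅G)
    1≤N : 1 ≤ N
    1≤N = proj₁ (encodes-size e)
    bounded : 8 * N + N * N < W
    bounded = power-bound N 1≤N
    open Evaluation {W} {N} bounded
    len≤6N : length w ≤ 6 * N
    len≤6N = <⇒≤ (proj₂ (encodes-size e))
    len≤B : length w ≤ B
    len≤B = small (≤-trans len≤6N (*-monoˡ-≤ N (m≤m+n 6 2)))
    E : Evaluated (length w) 0 0 (length w) (junk 0 0 0 0 0 0 0 0) (cells w) D (length w)
    E = evaluate e ≤-refl len≤B (holds-cells w) z≤n ≤-refl ≤-refl (cells-beyond w)
          (≤-trans (+-monoˡ-≤ N len≤6N) (≤-reflexive (+-comm (6 * N) N)))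
    1≤B : 1 ≤ B
    1≤B = small (≤-trans 1≤N (m≤m+n N (7 * N)))
    χ≤B : Evaluated.χ E ≤ B
    χ≤B = square ≤-refl (optimal-≤ {eval D} (Evaluated.opt E))
    whole : Exec W program (start-config w) _ _
    whole = straight start (fit len≤B , fit len≤B , fit 1≤B)
       then prefix (Evaluated.run E) (while-≡0 (n∸n≡0 (length w)))
       then straight finish (fit 1≤B , fit (subst (_≤ B) (sym (Evaluated.top-index E)) χ≤B))
    result = Exec.run whole (initial w) (initial-∼ w)
    time : ℕ
    time = 3 + (Evaluated.time E + 1 + 2)
    s : State
    s = proj₁ result
    out : output s ≡ Evaluated.χ E
    out = trans (proj₁ (proj₂ (proj₂ result)) 0) (Evaluated.top-index E)
    time≤ : time ≤ 80 * order G
    time≤ = begin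
      3 + (Evaluated.time E + 1 + 2)  ≡⟨ lemma (Evaluated.time E) ⟩
      Evaluated.time E + 6            ≤⟨ +-monoʳ-≤ (Evaluated.time E) (m≤m+n 6 19) ⟩
      Evaluated.time E + 25           ≤⟨ Evaluated.time-≤ E ⟩
      80 * N                          ≡⟨ cong (80 *_) n≡ ⟩
      80 * order G                    ∎
      where
      open ≤-Reasoning
      lemma : ∀ t → 3 + (t + 1 + 2) ≡ t + 6
      lemma = solve-∀
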